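{- For any $0<\delta,\theta<1$ there are numbers $C$ and $n_0$ such that the following holds for $n \ge n_0$. If $G$ is a digraph on $n$ vertices with $\lambda(G) \ge \theta n^2$, then $G$ contains a directed cycle of length $\ell$ for every integer $\ell$ with $C \le \ell \le (1-\delta)\theta n$.
   Context: A digraph has a finite vertex set and a set of ordered pairs of vertices (edges), with no loops or parallel edges. A directed cycle of length $\ell\ge 2$ consists of distinct vertices $v_1,\dots,v_\ell$ with edges $(v_i,v_{i+1})$, $1\le i<\ell$, and $(v_\ell,v_1)$. A digraph is strong if for every ordered pair of vertices $u,v$ there is a directed path from $u$ to $v$; a strong component is a maximal strong subdigraph. A digraph is periodic if there is an integer $p\ge 2$ dividing the length of every directed cycle in it. A digraph is pseudoperiodic if each of its strong components is periodic (possibly with different periods). $\lambda(G)$ is the minimum number of edges that must be deleted from $G$ to obtain a pseudoperiodic digraph.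
   Formalization: The parameters δ and θ range over rational numbers in (0,1) rather than real numbers; the real case follows by choosing a rational δ' slightly below δ and a rational θ' slightly below θ. -}

module Defs where

open import Data.Nat using (ℕ; zero; suc; _+_; _*_; _∸_; _≤_; _<_)
open import Data.Nat.Divisibility using (_∣_)
open import Data.Fin using (Fin; toℕ) renaming (zero to fzero; suc to fsuc)
open import Data.Bool using (Bool; true; false; _∧_; not; if_then_else_)
open import Data.Product using (Σ; ∃; _×_; _,_)
open import Relation.Binary.PropositionalEquality using (_≡_)
open import Relation.Nullary using (¬_)
open import Data.Integer using (+_)
import Data.Rational as ℚ

record Digraph (n : ℕ) : Set where
  field
    E      : Fin n → Fin n → Bool
    noLoop : ∀ v → E v v ≡ false
open Digraph public

-- Edge relation with vertex set Fin n (loops allowed at the type level; used for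
-- subdigraphs of a Digraph, which inherit looplessness).
Adj : ℕ → Set
Adj n = Fin n → Fin n → Bool

VSet : ℕ → Set
VSet n = Fin n → Bool

record CycleIn {n : ℕ} (E : Adj n) (S : VSet n) (ℓ : ℕ) : Set where
  field
    len≥2  : 2 ≤ ℓ
    vert   : Fin ℓ → Fin n
    inS    : ∀ i → S (vert i) ≡ true
    inj    : ∀ i j → vert i ≡ vert j → i ≡ j
    step   : ∀ i j → toℕ j ≡ suc (toℕ i) → E (vert i) (vert j) ≡ true
    close  : ∀ i j → toℕ i ≡ ℓ ∸ 1 → toℕ j ≡ 0 → E (vert i) (vert j) ≡ true

all₁ : ∀ {n} → VSet n
all₁ _ = true

Cycle : ∀ {n} → Adj n → ℕ → Set
Cycle E ℓ = CycleIn E all₁ ℓ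

data PathIn {n : ℕ} (E : Adj n) (S : VSet n) : Fin n → Fin n → Set where
  here : ∀ {u} → S u ≡ true → PathIn E S u u
  step : ∀ {u w v} → S u ≡ true → E u w ≡ true → PathIn E S w v → PathIn E S u v

Strong : ∀ {n} → Adj n → VSet n → Set
Strong E S = ∀ u v → S u ≡ true → S v ≡ true → PathIn E S u v

_⊆ᵥ_ : ∀ {n} → VSet n → VSet n → Set
S ⊆ᵥ T = ∀ v → S v ≡ true → T v ≡ true

StrongComponent : ∀ {n} → Adj n → VSet n → Set
StrongComponent {n} E S =
  (∃ λ v → S v ≡ true) × Strong E S ×
  (∀ T → S ⊆ᵥ T → Strong E T → T ⊆ᵥ S)

PeriodicOn : ∀ {n} → Adj n → VSet n → Set
PeriodicOn E S = Σ ℕ λ p → 2 ≤ p × (∀ ℓ → CycleIn E S ℓ → p ∣ ℓ)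

Pseudoperiodic : ∀ {n} → Adj n → Set
Pseudoperiodic E = ∀ S → StrongComponent E S → PeriodicOn E S

sumFin : ∀ n → (Fin n → ℕ) → ℕ
sumFin zero    f = 0
sumFin (suc n) f = f fzero + sumFin n (λ i → f (fsuc i))

_⊆ₑ_ : ∀ {n} → Adj n → Adj n → Set
H ⊆ₑ E = ∀ u v → H u v ≡ true → E u v ≡ true

deleted : ∀ {n} → Adj n → Adj n → ℕ
deleted {n} E H =
  sumFin n λ u → sumFin n λ v → if E u v ∧ not (H u v) then 1 else 0

-- λ(G) ≥ q : every pseudoperiodic digraph obtained from G by deleting edges
-- needs at least q deletions (i.e. min number of deletions ≥ q).
λ≥ℚ : ∀ {n} → Digraph n → ℚ.ℚ → Set
λ≥ℚ {n} G q = ∀ (H : Adj n) → H ⊆ₑ E G → Pseudoperiodic H →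
  q ℚ.≤ ((+ deleted (E G) H) ℚ./ 1)

toℚ : ℕ → ℚ.ℚ
toℚ m = (+ m) ℚ./ 1

{-# OPTIONS --safe #-}
module Submission where

open import Defs
open import Data.Bool using (Bool; true; false; _∧_; _∨_; not; if_then_else_)
open import Data.Bool.Properties using () renaming (_≟_ to _≟ᵇ_)
open import Data.Empty using (⊥; ⊥-elim)
open import Data.Fin using (Fin; toℕ; fromℕ<) renaming (zero to fzero; suc to fsuc)
import Data.Fin.Properties as Fin
import Data.Integer as ℤ
import Data.Integer.Properties as ℤ
open import Data.List using (List; []; _∷_; _++_; length; _∷ʳ_; lookup)
open import Data.List.Properties using (length-++)
open import Data.List.Membership.Propositional using (_∈_; _∉_)
import Data.List.Membership.DecPropositional as DecMembership
open import Data.List.Membership.Propositional.Properties using (∈-++⁻; ∈-++⁺ˡ; ∈-++⁺ʳ; ∈-lookup)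
open import Data.List.Relation.Unary.All.Properties using (¬Any⇒All¬)
open import Data.List.Relation.Unary.AllPairs using ([]; _∷_)
open import Data.List.Relation.Unary.Any using (here; there)
open import Data.List.Relation.Unary.Unique.Propositional using (Unique)
import Data.List.Relation.Unary.Unique.Propositional.Properties as Unique
open import Data.Nat using (ℕ; zero; suc; _+_; _*_; _∸_; _≤_; _<_; z≤n; s≤s; _%_; _/_; ∣_-_∣; >-nonZero; NonZero)
open import Data.Nat.Divisibility using (_∣_; _∣?_; divides; m%n≡0⇒n∣m; ∣m+n∣m⇒∣n; n∣m*n)
open import Data.Nat.DivMod using (m≡m%n+[m/n]*n; m%n<n; m/n≤m; /-monoˡ-≤; m*n/n≡m; m/n*n≤m; %-distribˡ-+; %-remove-+ʳ)
open import Data.Nat.Properties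
open import Data.Nat.Tactic.RingSolver using (solve-∀)
open import Data.Product using (Σ; ∃; _×_; _,_; proj₁; proj₂)
open import Data.Rational using (ℚ; 0ℚ; 1ℚ; _-_; mkℚ; ↥_; ↧_) renaming (_*_ to _*ℚ_; _≤_ to _≤ℚ_; _<_ to _<ℚ_)
import Data.Rational as ℚ
import Data.Rational.Properties as ℚ
open import Data.Rational.Unnormalised using (mkℚᵘ) renaming (_≃_ to _≃ᵘ_; _*_ to _*ᵘ_)
import Data.Rational.Unnormalised.Properties as ℚᵘ
open import Data.Sum using (_⊎_; inj₁; inj₂; [_,_]′)
open import Data.Vec using (Vec; []; _∷_)
import Data.Vec as Vec
open import Data.Vec.Properties using (lookup∘tabulate)
open import Function using (_∘_; id; case_of_; flip)
open import Relation.Binary.PropositionalEquality using (_≡_; refl; sym; trans; cong; cong₂; subst; subst₂)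
open import Relation.Nullary using (¬_; Dec; yes; no; does)
open import Relation.Nullary.Decidable using (_⊎-dec_; _×-dec_; _→-dec_; ¬?; map′; decidable-stable)

-- Split the vertex set along sparse cuts, deleting the few edges of each cut, until every
-- part S is either small or expanding. If λ(G) is large, then some expanding S cannot be made
-- pseudoperiodic by (ℓ + q)|S| deletions, where q is a small fraction of n, and such an S
-- contains a cycle of length exactly ℓ, for three reasons.
-- (1) Any two vertices of S are joined by paths of bounded length avoiding any given bounded
--     set. Were all such paths with common ends congruent in length modulo some p ≥ 2, then
--     path lengths from a fixed vertex would make S p-periodic after few deletions. So a
--     Euclidean descent yields a bounded gadget of paths realising all lengths in an interval.
-- (2) Boundedly many vertices dominate almost all of S, so almost every pair of vertices is
--     joined through the gadget, by paths of a prescribed length inside a bounded reserved set.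
-- (3) Outside the reserved set there is a path of any length m ≤ ℓ: otherwise, deleting at most
--     m edges turns the start of a maximal path into a source, and repeating this makes the
--     rest of S acyclic by at most m|S| deletions.

-- Booleans, finite sums and counting in vertex sets

∧-intro : ∀ {x y} → x ≡ true → y ≡ true → x ∧ y ≡ true
∧-intro refl refl = refl

∧-elimˡ : ∀ {x y} → x ∧ y ≡ true → x ≡ true
∧-elimˡ {true} _ = refl

∧-elimʳ : ∀ {x y} → x ∧ y ≡ true → y ≡ true
∧-elimʳ {true} p = p

∨-introˡ : ∀ {x y} → x ≡ true → x ∨ y ≡ true
∨-introˡ refl = refl

∨-introʳ : ∀ {x y} → y ≡ true → x ∨ y ≡ true
∨-introʳ {true}  _ = refl
∨-introʳ {false} p = p

∨-elim : ∀ {x y} → x ∨ y ≡ true → x ≡ true ⊎ y ≡ true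
∨-elim {true}  _ = inj₁ refl
∨-elim {false} p = inj₂ p

not-intro : ∀ {x} → ¬ (x ≡ true) → not x ≡ true
not-intro {true}  p = ⊥-elim (p refl)
not-intro {false} p = refl

not-elim : ∀ {x} → not x ≡ true → ¬ (x ≡ true)
not-elim {false} _ ()

true? : ∀ x → x ≡ true ⊎ ¬ (x ≡ true)
true? true  = inj₁ refl
true? false = inj₂ λ ()

bool? : ∀ x → x ≡ true ⊎ x ≡ false
bool? true  = inj₁ refl
bool? false = inj₂ refl

does-intro : ∀ {P : Set} (P? : Dec P) → P → does P? ≡ true
does-intro (yes _) _ = refl
does-intro (no ¬p) p = ⊥-elim (¬p p)

does-elim : ∀ {P : Set} (P? : Dec P) → does P? ≡ true → P
does-elim (yes p) _ = p

𝟙 : Bool → ℕ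
𝟙 true  = 1
𝟙 false = 0

𝟙-mono : ∀ {x y} → (x ≡ true → y ≡ true) → 𝟙 x ≤ 𝟙 y
𝟙-mono {false}         _ = z≤n
𝟙-mono {true}  {true}  _ = ≤-refl
𝟙-mono {true}  {false} p = case p refl of λ ()

𝟙-∪ : ∀ {x y z} → (x ≡ true → y ≡ true ⊎ z ≡ true) → 𝟙 x ≤ 𝟙 y + 𝟙 z
𝟙-∪ {false}                _ = z≤n
𝟙-∪ {true} {true}          _ = s≤s z≤n
𝟙-∪ {true} {false} {true}  _ = ≤-refl
𝟙-∪ {true} {false} {false} p = case p refl of λ { (inj₁ ()) ; (inj₂ ()) }

𝟙-disjoint : ∀ {x y z} → (y ≡ true → x ≡ true) → (z ≡ true → x ≡ true) →
             (y ≡ true → ¬ (z ≡ true)) → 𝟙 y + 𝟙 z ≤ 𝟙 x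
𝟙-disjoint {y = false}             _ q _ = 𝟙-mono q
𝟙-disjoint {y = true} {z = true}   _ _ d = ⊥-elim (d refl refl)
𝟙-disjoint {y = true} {z = false}  p _ _ = 𝟙-mono p

sum-mono : ∀ {n} {f g : Fin n → ℕ} → (∀ v → f v ≤ g v) → sumFin n f ≤ sumFin n g
sum-mono {zero}  _ = z≤n
sum-mono {suc n} h = +-mono-≤ (h fzero) (sum-mono (h ∘ fsuc))

sum-cong : ∀ {n} {f g : Fin n → ℕ} → (∀ v → f v ≡ g v) → sumFin n f ≡ sumFin n g
sum-cong h = ≤-antisym (sum-mono (≤-reflexive ∘ h)) (sum-mono (≤-reflexive ∘ sym ∘ h))

sum-+ : ∀ {n} (f g : Fin n → ℕ) → sumFin n (λ v → f v + g v) ≡ sumFin n f + sumFin n g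
sum-+ {zero}  f g = refl
sum-+ {suc n} f g rewrite sum-+ (f ∘ fsuc) (g ∘ fsuc) =
  swap (f fzero) (g fzero) (sumFin n (f ∘ fsuc)) (sumFin n (g ∘ fsuc))
  where
  swap : ∀ a b c d → a + b + (c + d) ≡ a + c + (b + d)
  swap = solve-∀

sum-* : ∀ {n} k (f : Fin n → ℕ) → sumFin n (λ v → k * f v) ≡ k * sumFin n f
sum-* {zero}  k f = sym (*-zeroʳ k)
sum-* {suc n} k f rewrite sum-* k (f ∘ fsuc) = sym (*-distribˡ-+ k (f fzero) _)

sum-0 : ∀ n → sumFin n (λ _ → 0) ≡ 0
sum-0 zero    = refl
sum-0 (suc n) = sum-0 n

sum-swap : ∀ {m n} (f : Fin m → Fin n → ℕ) →
           sumFin m (λ u → sumFin n (f u)) ≡ sumFin n (λ v → sumFin m (λ u → f u v))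
sum-swap {zero}  {n} f = sym (sum-0 n)
sum-swap {suc m} {n} f rewrite sum-swap (f ∘ fsuc) =
  sym (sum-+ (f fzero) (λ v → sumFin m (λ u → f (fsuc u) v)))

term≤sum : ∀ {n} (f : Fin n → ℕ) v → f v ≤ sumFin n f
term≤sum f fzero    = m≤m+n _ _
term≤sum f (fsuc v) = ≤-trans (term≤sum (f ∘ fsuc) v) (m≤n+m _ _)

card : ∀ {n} → VSet n → ℕ
card {n} A = sumFin n (𝟙 ∘ A)

card₂ : ∀ {n} → (Fin n → Fin n → Bool) → ℕ
card₂ {n} R = sumFin n λ u → card (R u)

card-mono : ∀ {n} {A B : VSet n} → A ⊆ᵥ B → card A ≤ card B
card-mono h = sum-mono λ v → 𝟙-mono (h v)

card-∪ : ∀ {n} {A B C : VSet n} → (∀ v → A v ≡ true → B v ≡ true ⊎ C v ≡ true) →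
         card A ≤ card B + card C
card-∪ {B = B} {C} h =
  ≤-trans (sum-mono λ v → 𝟙-∪ (h v)) (≤-reflexive (sum-+ (𝟙 ∘ B) (𝟙 ∘ C)))

card-disjoint : ∀ {n} {A B C : VSet n} → B ⊆ᵥ A → C ⊆ᵥ A →
                (∀ v → B v ≡ true → ¬ (C v ≡ true)) → card B + card C ≤ card A
card-disjoint {B = B} {C} b c d =
  ≤-trans (≤-reflexive (sym (sum-+ (𝟙 ∘ B) (𝟙 ∘ C)))) (sum-mono λ v → 𝟙-disjoint (b v) (c v) (d v))

card-empty : ∀ {n} {A : VSet n} → (∀ v → ¬ (A v ≡ true)) → card A ≡ 0
card-empty {n} {A} h = trans (sum-cong zero-at) (sum-0 n)
  where
  zero-at : ∀ v → 𝟙 (A v) ≡ 0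
  zero-at v with A v in eq
  ... | true  = ⊥-elim (h v eq)
  ... | false = refl

card-pos : ∀ {n} {A : VSet n} v → A v ≡ true → 0 < card A
card-pos {A = A} v h = ≤-trans (≤-reflexive (sym (cong 𝟙 h))) (term≤sum (𝟙 ∘ A) v)

card-all : ∀ n → card {n} all₁ ≡ n
card-all zero    = refl
card-all (suc n) = cong suc (card-all n)

card≤n : ∀ {n} (A : VSet n) → card A ≤ n
card≤n {n} A = ≤-trans (card-mono {A = A} {B = all₁} λ _ _ → refl) (≤-reflexive (card-all n))

card₂-mono : ∀ {n} {R Q : Fin n → Fin n → Bool} → (∀ u v → R u v ≡ true → Q u v ≡ true) →
             card₂ R ≤ card₂ Q
card₂-mono h = sum-mono λ u → card-mono (h u)

card₂-∪ : ∀ {n} {R P Q : Fin n → Fin n → Bool} →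
          (∀ u v → R u v ≡ true → P u v ≡ true ⊎ Q u v ≡ true) → card₂ R ≤ card₂ P + card₂ Q
card₂-∪ {P = P} {Q} h = ≤-trans (sum-mono λ u → card-∪ (h u))
  (≤-reflexive (sum-+ (card ∘ P) (card ∘ Q)))

card₂-swap : ∀ {n} (R : Fin n → Fin n → Bool) → card₂ R ≡ card₂ (λ v u → R u v)
card₂-swap R = sum-swap λ u v → 𝟙 (R u v)

-- The factor `k` expresses rows of size at most m/k without division.
card₂-rows≤* : ∀ {n} k {R : Fin n → Fin n → Bool} {A : VSet n} {m} →
               (∀ u v → R u v ≡ true → A u ≡ true) →
               (∀ u → A u ≡ true → k * card (R u) ≤ m) → k * card₂ R ≤ m * card A
card₂-rows≤* k {R} {A} {m} supp rows = ≤-trans (≤-reflexive (sym (sum-* k (card ∘ R))))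
  (≤-trans (sum-mono row) (≤-reflexive (sum-* m (𝟙 ∘ A))))
  where
  row : ∀ u → k * card (R u) ≤ m * 𝟙 (A u)
  row u with A u in eq
  ... | true  = ≤-trans (rows u eq) (≤-reflexive (sym (*-identityʳ m)))
  ... | false = ≤-trans (≤-reflexive (trans (cong (k *_) (card-empty {A = R u} λ v r →
    case trans (sym eq) (supp u v r) of λ ())) (*-zeroʳ k))) z≤n

card₂-rows≤ : ∀ {n} {R : Fin n → Fin n → Bool} {A : VSet n} {m} →
              (∀ u v → R u v ≡ true → A u ≡ true) →
              (∀ u → A u ≡ true → card (R u) ≤ m) → card₂ R ≤ m * card A
card₂-rows≤ {R = R} supp rows = ≤-trans (≤-reflexive (sym (*-identityˡ (card₂ R))))
  (card₂-rows≤* 1 supp λ u au → ≤-trans (≤-reflexive (*-identityˡ (card (R u)))) (rows u au))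

card₂-rows≥* : ∀ {n} k {R : Fin n → Fin n → Bool} {A : VSet n} {m} →
               (∀ u → A u ≡ true → m ≤ k * card (R u)) → m * card A ≤ k * card₂ R
card₂-rows≥* k {R} {A} {m} rows = ≤-trans (≤-reflexive (sym (sum-* m (𝟙 ∘ A))))
  (≤-trans (sum-mono row) (≤-reflexive (sum-* k (card ∘ R))))
  where
  row : ∀ u → m * 𝟙 (A u) ≤ k * card (R u)
  row u with A u in eq
  ... | true  = ≤-trans (≤-reflexive (*-identityʳ m)) (rows u eq)
  ... | false = ≤-trans (≤-reflexive (*-zeroʳ m)) z≤n

find : ∀ {n} (A : VSet n) → (∃ λ v → A v ≡ true) ⊎ (∀ v → ¬ (A v ≡ true))
find {zero}  A = inj₂ λ ()
find {suc n} A with true? (A fzero) | find (A ∘ fsuc)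
... | inj₁ h | _            = inj₁ (fzero , h)
... | inj₂ _ | inj₁ (v , h) = inj₁ (fsuc v , h)
... | inj₂ h | inj₂ g       = inj₂ λ { fzero → h ; (fsuc v) → g v }

infixl 21 _∖_
infixl 22 _∩_

_∩_ _∖_ : ∀ {n} → VSet n → VSet n → VSet n
(A ∩ B) v = A v ∧ B v
(A ∖ B) v = A v ∧ not (B v)

single : ∀ {n} → Fin n → VSet n
single u v = does (v Fin.≟ u)

⟨_⟩ : ∀ {n} → List (Fin n) → VSet n
⟨ Z ⟩ v = does (DecMembership._∈?_ Fin._≟_ v Z)

∈⇒⟨⟩ : ∀ {n} {Z : List (Fin n)} {v} → v ∈ Z → ⟨ Z ⟩ v ≡ true
∈⇒⟨⟩ {Z = Z} {v} = does-intro (DecMembership._∈?_ Fin._≟_ v Z)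

⟨⟩⇒∈ : ∀ {n} {Z : List (Fin n)} {v} → ⟨ Z ⟩ v ≡ true → v ∈ Z
⟨⟩⇒∈ {Z = Z} {v} = does-elim (DecMembership._∈?_ Fin._≟_ v Z)

card-single : ∀ {n} (u : Fin n) → card (single u) ≤ 1
card-single {suc n} fzero    =
  ≤-reflexive (cong suc (card-empty {A = single {suc n} fzero ∘ fsuc} λ _ ()))
card-single {suc n} (fsuc u) = ≤-trans (card-mono {A = single (fsuc u) ∘ fsuc} λ v h →
  does-intro (v Fin.≟ u) (Fin.suc-injective (does-elim (fsuc v Fin.≟ fsuc u) h))) (card-single u)

card-⟨⟩ : ∀ {n} (Z : List (Fin n)) → card ⟨ Z ⟩ ≤ length Z
card-⟨⟩ {n} [] = ≤-reflexive (card-empty {n} {⟨ [] ⟩} λ v h → case ⟨⟩⇒∈ {Z = []} {v} h of λ ())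
card-⟨⟩ (z ∷ Z) = ≤-trans (card-∪ {B = single z} {⟨ Z ⟩} split) (+-mono-≤ (card-single z) (card-⟨⟩ Z))
  where
  split : ∀ v → ⟨ z ∷ Z ⟩ v ≡ true → single z v ≡ true ⊎ ⟨ Z ⟩ v ≡ true
  split v h with ⟨⟩⇒∈ {Z = z ∷ Z} h
  ... | here p  = inj₁ (does-intro (v Fin.≟ z) p)
  ... | there p = inj₂ (∈⇒⟨⟩ p)

card-∖ : ∀ {n} (A B : VSet n) → card A ≤ card (A ∖ B) + card B
card-∖ A B = card-∪ {B = A ∖ B} {B} λ v a → case true? (B v) of λ
  { (inj₁ b) → inj₂ b ; (inj₂ b) → inj₁ (∧-intro a (not-intro b)) }

card-∩∖ : ∀ {n} (S A : VSet n) → card (S ∩ A) + card (S ∖ A) ≤ card S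
card-∩∖ S A = card-disjoint {A = S} {S ∩ A} {S ∖ A} (λ _ → ∧-elimˡ) (λ _ → ∧-elimˡ)
  λ v p q → not-elim (∧-elimʳ {S v} q) (∧-elimʳ {S v} p)

-- Certificates of pseudoperiodicity

%-suc : ∀ a b p .{{_ : NonZero p}} → a % p ≡ b % p → suc a % p ≡ suc b % p
%-suc a b p h = trans (%-distribˡ-+ 1 a p) (trans (cong (λ r → (1 % p + r) % p) h) (sym (%-distribˡ-+ 1 b p)))

%-shift⇒∣ : ∀ a b p .{{_ : NonZero p}} → (a + b) % p ≡ a % p → p ∣ b
%-shift⇒∣ a b p h = ∣m+n∣m⇒∣n (divides ((a + b) / p) eq) (n∣m*n (a / p))
  where
  eq : a / p * p + b ≡ (a + b) / p * p
  eq = +-cancelˡ-≡ (a % p) _ _ (trans (sym (+-assoc (a % p) _ b))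
    (trans (cong (_+ b) (sym (m≡m%n+[m/n]*n a p)))
    (trans (m≡m%n+[m/n]*n (a + b) p) (cong (_+ (a + b) / p * p) h))))

∣-∣⇒% : ∀ a b p .{{_ : NonZero p}} → p ∣ ∣ a - b ∣ → a % p ≡ b % p
∣-∣⇒% a b p h with ≤-total a b
... | inj₁ a≤b = trans (sym (%-remove-+ʳ a (subst (p ∣_) (m≤n⇒∣m-n∣≡n∸m a≤b) h)))
                       (cong (_% p) (m+[n∸m]≡n a≤b))
... | inj₂ b≤a = trans (cong (_% p) (sym (m+[n∸m]≡n b≤a)))
                       (%-remove-+ʳ b (subst (p ∣_) (trans (∣-∣-comm a b) (m≤n⇒∣m-n∣≡n∸m b≤a)) h))

-- Edges may descend in rank, and between vertices of equal rank φ has to increase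
-- by one modulo the period 2 + per; deleting all other edges leaves a pseudoperiodic digraph.
record Cert (n : ℕ) : Set where
  field
    rank per φ : Fin n → ℕ

module _ {n : ℕ} (c : Cert n) where
  open Cert c

  OK : Fin n → Fin n → Set
  OK u v = rank v < rank u ⊎
    (rank v ≡ rank u × per v ≡ per u × suc (φ u) % (2 + per u) ≡ φ v % (2 + per u))

  OK? : ∀ u v → Dec (OK u v)
  OK? u v = (rank v <? rank u) ⊎-dec
    ((rank v ≟ rank u) ×-dec ((per v ≟ per u) ×-dec (suc (φ u) % (2 + per u) ≟ φ v % (2 + per u))))

  kept : Adj n → Adj n
  kept E u v = E u v ∧ does (OK? u v)

  bad : Adj n → VSet n → ℕ
  bad E S = card₂ λ u v → S u ∧ S v ∧ E u v ∧ not (does (OK? u v))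

  module _ {E : Adj n} where

    rank-path : ∀ {S u v} → PathIn (kept E) S u v → rank v ≤ rank u
    rank-path (here _)     = ≤-refl
    rank-path (step {u} {w} _ e p) with does-elim (OK? u w) (∧-elimʳ {E u w} e)
    ... | inj₁ lt       = ≤-trans (rank-path p) (<⇒≤ lt)
    ... | inj₂ (eq , _) = ≤-trans (rank-path p) (≤-reflexive eq)

    module _ {S : VSet n} (strong : Strong (kept E) S) where

      rank-const : ∀ {u v} → S u ≡ true → S v ≡ true → rank u ≡ rank v
      rank-const {u} {v} su sv = ≤-antisym (rank-path (strong v u sv su)) (rank-path (strong u v su sv))

      edge-level : ∀ {u v} → S u ≡ true → S v ≡ true → kept E u v ≡ true →
                   per v ≡ per u × suc (φ u) % (2 + per u) ≡ φ v % (2 + per u)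
      edge-level {u} {v} su sv e with does-elim (OK? u v) (∧-elimʳ {E u v} e)
      ... | inj₁ lt      = ⊥-elim (<-irrefl (rank-const sv su) lt)
      ... | inj₂ (_ , h) = h

      source∈ : ∀ {u v} → PathIn (kept E) S u v → S u ≡ true
      source∈ (here s)     = s
      source∈ (step s _ _) = s

      per-path : ∀ {u v} → PathIn (kept E) S u v → per v ≡ per u
      per-path (here _)     = refl
      per-path (step s e p) = trans (per-path p) (proj₁ (edge-level s (source∈ p) e))

      per-const : ∀ {u v} → S u ≡ true → S v ≡ true → per u ≡ per v
      per-const {u} {v} su sv = per-path (strong v u sv su)

      φ-step : ∀ {u v} p → per u ≡ p → S u ≡ true → S v ≡ true → kept E u v ≡ true →
               suc (φ u) % (2 + p) ≡ φ v % (2 + p)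
      φ-step _ refl su sv e = proj₂ (edge-level su sv e)


      -- Rank cannot rise along kept edges, so it is constant on a strong set and no kept edge
      -- inside descends. Hence `per` is constant too, and `φ` gains one modulo the period with each
      -- edge; going once round the cycle gains `ℓ` and returns to the same value.
      cycle-period : ∀ {v₀ ℓ} → S v₀ ≡ true → CycleIn (kept E) S ℓ → (2 + per v₀) ∣ ℓ
      cycle-period {v₀} {suc m} s₀ C = %-shift⇒∣ (φ start) (suc m) p
        (trans (cong (_% p) (+-comm (φ start) (suc m)))
        (trans (%-suc (m + φ start) (φ (vert (fromℕ< ≤-refl))) p (along m ≤-refl))
        (φ-step _ (per-at _) (inS _) (inS _) (close _ fzero (Fin.toℕ-fromℕ< ≤-refl) refl))))
        where
        open CycleIn C hiding (step)
        p = 2 + per v₀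
        start = vert fzero
        per-at : ∀ i → per (vert i) ≡ per v₀
        per-at i = per-const (inS i) s₀
        along : ∀ k (lt : k < suc m) → (k + φ start) % p ≡ φ (vert (fromℕ< lt)) % p
        along zero    (s≤s z≤n) = refl
        along (suc k) lt = trans (%-suc (k + φ start) (φ (vert (fromℕ< k<))) p (along k k<))
          (φ-step _ (per-at _) (inS _) (inS _) (CycleIn.step C _ _
            (trans (Fin.toℕ-fromℕ< lt) (cong suc (sym (Fin.toℕ-fromℕ< k<))))))
          where
          k< : k < suc m
          k< = <-trans (n<1+n k) lt

    kept-pseudoperiodic : Pseudoperiodic (kept E)
    kept-pseudoperiodic S ((v₀ , s₀) , strong , _) =
      2 + per v₀ , s≤s (s≤s z≤n) , λ ℓ → cycle-period strong s₀

  deleted≤bad : ∀ (E : Adj n) → deleted E (kept E) ≤ bad E all₁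
  deleted≤bad E = sum-mono λ u → sum-mono λ v → entry (E u v) (does (OK? u v))
    where
    entry : ∀ x y → (if x ∧ not (x ∧ y) then 1 else 0) ≤ 𝟙 (true ∧ true ∧ x ∧ not y)
    entry false _     = z≤n
    entry true  false = ≤-refl
    entry true  true  = z≤n

bad-elim : ∀ {n} (c : Cert n) (E : Adj n) (S : VSet n) u v →
           S u ∧ S v ∧ E u v ∧ not (does (OK? c u v)) ≡ true →
           S u ≡ true × S v ≡ true × E u v ≡ true × ¬ OK c u v
bad-elim c E S u v h =
  ∧-elimˡ h , ∧-elimˡ (∧-elimʳ {S u} h) , ∧-elimˡ (∧-elimʳ {S v} (∧-elimʳ {S u} h)) ,
  λ ok → not-elim (∧-elimʳ {E u v} (∧-elimʳ {S v} (∧-elimʳ {S u} h))) (does-intro (OK? c u v) ok)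

bad-intro : ∀ {n} (c : Cert n) (E : Adj n) (S : VSet n) u v →
            S u ≡ true → S v ≡ true → E u v ≡ true → ¬ OK c u v →
            S u ∧ S v ∧ E u v ∧ not (does (OK? c u v)) ≡ true
bad-intro c E S u v su sv e ¬ok =
  ∧-intro su (∧-intro sv (∧-intro e (not-intro λ d → ¬ok (does-elim (OK? c u v) d))))

-- Losses of certificates on subsets and across cuts

edges : ∀ {n} → Adj n → VSet n → VSet n → ℕ
edges E A B = card₂ λ u v → A u ∧ B v ∧ E u v

trivial-cert : ∀ {n} → Cert n
trivial-cert = record { rank = λ _ → 0 ; per = λ _ → 0 ; φ = λ _ → 0 }

bad≤card² : ∀ {n} (c : Cert n) E S → bad c E S ≤ card S * card S
bad≤card² c E S = card₂-rows≤ {A = S} (λ _ _ → ∧-elimˡ)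
  λ u su → card-mono {B = S} λ v h → proj₁ (proj₂ (bad-elim c E S u v h))

-- A bad pair of `S` outside `T` has one end in `S ∖ T` and the other in `S`; either end may be the
-- deviant one, whence the factor 2.
bad-restrict : ∀ {n} (c : Cert n) E S T → bad c E S ≤ bad c E T + 2 * card (S ∖ T) * card S
bad-restrict {n} c E S T =
  ≤-trans (card₂-∪ {P = P} {Q₁∪Q₂} split) (+-monoʳ-≤ (bad c E T) (≤-trans (card₂-∪ {P = Q₁} {Q₂} (λ _ _ → ∨-elim))
    (≤-trans (+-mono-≤ size₁ size₂) (≤-reflexive (double (card (S ∖ T)) (card S))))))
  where
  double : ∀ a b → b * a + a * b ≡ 2 * a * b
  double = solve-∀
  P Q₁ Q₂ Q₁∪Q₂ : Fin n → Fin n → Bool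
  P u v = T u ∧ T v ∧ E u v ∧ not (does (OK? c u v))
  Q₁ u v = (S ∖ T) u ∧ S v
  Q₂ u v = S u ∧ (S ∖ T) v
  Q₁∪Q₂ u v = Q₁ u v ∨ Q₂ u v
  size₁ : card₂ Q₁ ≤ card S * card (S ∖ T)
  size₁ = card₂-rows≤ {A = S ∖ T} (λ _ _ → ∧-elimˡ) λ u _ → card-mono {B = S} λ v → ∧-elimʳ {(S ∖ T) u}
  size₂ : card₂ Q₂ ≤ card (S ∖ T) * card S
  size₂ = card₂-rows≤ {A = S} (λ _ _ → ∧-elimˡ) λ u _ → card-mono {B = S ∖ T} λ v → ∧-elimʳ {S u}
  split : ∀ u v → S u ∧ S v ∧ E u v ∧ not (does (OK? c u v)) ≡ true → P u v ≡ true ⊎ Q₁∪Q₂ u v ≡ true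
  split u v h with bad-elim c E S u v h | true? (T u) | true? (T v)
  ... | su , sv , e , ¬ok | inj₁ tu | inj₁ tv = inj₁ (bad-intro c E T u v tu tv e ¬ok)
  ... | su , sv , e , ¬ok | inj₂ tu | _       = inj₂ (∨-introˡ (∧-intro (∧-intro su (not-intro tu)) sv))
  ... | su , sv , e , ¬ok | _       | inj₂ tv = inj₂ (∨-introʳ {Q₁ u v} (∧-intro su (∧-intro sv (not-intro tv))))

-- The vertices outside A are ranked above those of A, so only the edges leaving A are lost.
combine : ∀ {n} → VSet n → Cert n → Cert n → Cert n
combine {n} A c d = record
  { rank = λ v → if A v then rank c v else suc (sumFin n (rank c)) + rank d v
  ; per  = λ v → if A v then per c v else per d v
  ; φ    = λ v → if A v then φ c v else φ d v }
  where open Cert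

bad-combine : ∀ {n} (E : Adj n) S A (c d : Cert n) →
              bad (combine A c d) E S ≤ bad c E (S ∩ A) + bad d E (S ∖ A) + edges E (S ∩ A) (S ∖ A)
bad-combine {n} E S A c d =
  ≤-trans (card₂-∪ {P = PQ} {R} split) (+-monoˡ-≤ (card₂ R) (card₂-∪ {P = P} {Q} (λ _ _ → ∨-elim)))
  where
  open Cert
  B = S ∩ A
  B′ = S ∖ A
  P Q R PQ : Fin n → Fin n → Bool
  P u v = B u ∧ B v ∧ E u v ∧ not (does (OK? c u v))
  Q u v = B′ u ∧ B′ v ∧ E u v ∧ not (does (OK? d u v))
  R u v = B u ∧ B′ v ∧ E u v
  PQ u v = P u v ∨ Q u v
  okˡ : ∀ u v → A u ≡ true → A v ≡ true → OK c u v → OK (combine A c d) u v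
  okˡ u v au av ok rewrite au | av = ok
  okʳ : ∀ u v → A u ≡ false → A v ≡ false → OK d u v → OK (combine A c d) u v
  okʳ u v au av ok rewrite au | av = case ok of λ
    { (inj₁ lt) → inj₁ (+-monoʳ-< _ lt) ; (inj₂ (eq , rest)) → inj₂ (cong (suc (sumFin n (rank c)) +_) eq , rest) }
  ok↓ : ∀ u v → A u ≡ false → A v ≡ true → OK (combine A c d) u v
  ok↓ u v au av rewrite au | av = inj₁ (s≤s (≤-trans (term≤sum (rank c) v) (m≤m+n _ _)))
  split : ∀ u v → S u ∧ S v ∧ E u v ∧ not (does (OK? (combine A c d) u v)) ≡ true →
          PQ u v ≡ true ⊎ R u v ≡ true
  split u v h with bad-elim (combine A c d) E S u v h | bool? (A u) | bool? (A v)
  ... | su , sv , e , ¬ok | inj₁ au | inj₁ av = inj₁ (∨-introˡ (bad-intro c E B u v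
    (∧-intro su au) (∧-intro sv av) e (¬ok ∘ okˡ u v au av)))
  ... | su , sv , e , ¬ok | inj₂ au | inj₂ av = inj₁ (∨-introʳ {P u v} (bad-intro d E B′ u v
    (∧-intro su (cong not au)) (∧-intro sv (cong not av)) e (¬ok ∘ okʳ u v au av)))
  ... | su , sv , e , ¬ok | inj₁ au | inj₂ av = inj₂ (∧-intro (∧-intro su au) (∧-intro (∧-intro sv (cong not av)) e))
  ... | su , sv , e , ¬ok | inj₂ au | inj₁ av = ⊥-elim (¬ok (ok↓ u v au av))

-- Used as the set `A` of `combine`, it puts `u` alone on the upper level, so only the edges into
-- `u` are lost.
except : ∀ {n} → Fin n → VSet n
except u v = not (single u v)

module _ {n} (S : VSet n) (u : Fin n) where

  ∖except : ∀ v → (S ∖ except u) v ≡ true → v ≡ u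
  ∖except v h = case true? (single u v) of λ
    { (inj₁ e)  → does-elim (v Fin.≟ u) e
    ; (inj₂ ne) → ⊥-elim (not-elim (∧-elimʳ {S v} h) (not-intro ne)) }

  card-∖except : card (S ∖ except u) ≤ 1
  card-∖except = ≤-trans (card-mono {B = single u} λ v h → does-intro (v Fin.≟ u) (∖except v h)) (card-single u)

  ∖except-self : S u ≡ true → (S ∖ except u) u ≡ true
  ∖except-self su = ∧-intro su (not-intro λ h → not-elim h (does-intro (u Fin.≟ u) refl))

  card-except< : S u ≡ true → suc (card (S ∩ except u)) ≤ card S
  card-except< su = ≤-trans (≤-reflexive (+-comm 1 (card (S ∩ except u))))
    (≤-trans (+-monoʳ-≤ (card (S ∩ except u)) (card-pos {A = S ∖ except u} u (∖except-self su)))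
             (card-∩∖ S (except u)))

  card≤1+except : card S ≤ suc (card (S ∩ except u))
  card≤1+except = ≤-trans (card-∖ S (single u))
    (≤-trans (+-monoʳ-≤ _ (card-single u)) (≤-reflexive (+-comm _ 1)))

  edges-except : ∀ E → edges E (S ∩ except u) (S ∖ except u) ≤ card (S ∩ λ w → E w u)
  edges-except E = ≤-trans (≤-reflexive (card₂-swap λ v w → (S ∩ except u) v ∧ (S ∖ except u) w ∧ E v w))
    (≤-trans (card₂-rows≤ {A = S ∖ except u} {card (S ∩ λ w → E w u)}
      (λ w v h → ∧-elimˡ (∧-elimʳ {(S ∩ except u) v} h))
      (λ w w∈ → card-mono λ v h → ∧-intro (∧-elimˡ (∧-elimˡ {(S ∩ except u) v} h))
        (subst (λ w → E v w ≡ true) (∖except w w∈) (∧-elimʳ {(S ∖ except u) w} (∧-elimʳ {(S ∩ except u) v} h)))))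
    (≤-trans (*-monoʳ-≤ (card (S ∩ λ w → E w u)) card-∖except) (≤-reflexive (*-identityʳ _))))

-- Walks and paths

infix 4 _⊑_
_⊑_ : ∀ {n} → List (Fin n) → List (Fin n) → Set
p ⊑ q = ∀ {x} → x ∈ p → x ∈ q

unique-∷ : ∀ {n} {x : Fin n} {p} → x ∉ p → Unique p → Unique (x ∷ p)
unique-∷ x∉p u = ¬Any⇒All¬ _ x∉p ∷ u

unique-head : ∀ {n} {x : Fin n} {p} → Unique (x ∷ p) → x ∉ p
unique-head = Unique.Unique[x∷xs]⇒x∉xs

lookup-injective : ∀ {n} {p : List (Fin n)} → Unique p → ∀ i j → lookup p i ≡ lookup p j → i ≡ j
lookup-injective {p = _ ∷ _} u       fzero    fzero    _  = refl
lookup-injective {p = _ ∷ _} u       fzero    (fsuc j) eq = ⊥-elim (unique-head u (subst (_∈ _) (sym eq) (∈-lookup j)))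
lookup-injective {p = _ ∷ _} u       (fsuc i) fzero    eq = ⊥-elim (unique-head u (subst (_∈ _) eq (∈-lookup i)))
lookup-injective {p = _ ∷ _} (_ ∷ u) (fsuc i) (fsuc j) eq = cong fsuc (lookup-injective u i j eq)

unique-++ : ∀ {n} {p q : List (Fin n)} → Unique p → Unique q →
            (∀ {x} → x ∈ p → x ∉ q) → Unique (p ++ q)
unique-++ u v d = Unique.++⁺ u v λ (x∈p , x∈q) → d x∈p x∈q

_∈?_ : ∀ {n} (x : Fin n) p → Dec (x ∈ p)
_∈?_ = DecMembership._∈?_ Fin._≟_

-- The list of a walk omits its first vertex and contains its last one, so that a closed
-- walk without repetitions in its list is a cycle.
data Walk {n} (E : Adj n) : Fin n → List (Fin n) → Fin n → Set where
  []  : ∀ {u} → Walk E u [] u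
  _∷_ : ∀ {u w v p} → E u w ≡ true → Walk E w p v → Walk E u (w ∷ p) v

module _ {n} {E : Adj n} where

  infixr 5 _+++_
  _+++_ : ∀ {u v w p q} → Walk E u p v → Walk E v q w → Walk E u (p ++ q) w
  []       +++ W = W
  (e ∷ V) +++ W = e ∷ (V +++ W)

  walk-first : ∀ {u p v} → Walk E u p v → ∀ j → toℕ j ≡ 0 → E u (lookup p j) ≡ true
  walk-first (e ∷ _) fzero _ = e

  walk-last : ∀ {u p v} → Walk E u p v → ∀ i → suc (toℕ i) ≡ length p → lookup p i ≡ v
  walk-last (e ∷ [])        fzero    _  = refl
  walk-last (e ∷ W@(_ ∷ _)) (fsuc i) eq = walk-last W i (suc-injective eq)

  walk-step : ∀ {u p v} → Walk E u p v → ∀ i j → toℕ j ≡ suc (toℕ i) →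
              E (lookup p i) (lookup p j) ≡ true
  walk-step (e ∷ W) fzero    (fsuc j) eq = walk-first W j (suc-injective eq)
  walk-step (e ∷ W) (fsuc i) (fsuc j) eq = walk-step W i j (suc-injective eq)

  closed-walk⇒cycle : ∀ {x p} → Walk E x p x → Unique p → 2 ≤ length p → Cycle E (length p)
  closed-walk⇒cycle {x} {p} W u 2≤ = record
    { len≥2 = 2≤
    ; vert  = lookup p
    ; inS   = λ _ → refl
    ; inj   = λ i j → lookup-injective u i j
    ; step  = walk-step W
    ; close = λ i j i-last j-first → subst (λ y → E y (lookup p j) ≡ true)
        (sym (walk-last W i (trans (cong suc i-last) (m+[n∸m]≡n (≤-trans (s≤s z≤n) 2≤)))))
        (walk-first W j j-first) }

  end∈ : ∀ {u p v} → Walk E u p v → v ∈ u ∷ p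
  end∈ []      = here refl
  end∈ (_ ∷ W) = there (end∈ W)

  cut-at : ∀ {w p v x} → Walk E w p v → Unique p → x ∈ p →
           Σ (List (Fin n)) λ r → Walk E x r v × Unique (x ∷ r) × length (x ∷ r) ≤ length p × x ∷ r ⊑ p
  cut-at (e ∷ W) u         (here refl) = _ , W , u , ≤-refl , id
  cut-at (e ∷ W) (_ ∷ u) (there x∈p) =
    let r , W′ , u′ , le , sub = cut-at W u x∈p in r , W′ , u′ , m≤n⇒m≤1+n le , there ∘ sub

  -- Loops are cut out from the back: if the new vertex `w` recurs in the part already cleaned, the
  -- walk jumps to that recurrence.
  remove-loops : ∀ {u p v} → Walk E u p v →
                 Σ (List (Fin n)) λ q → Walk E u q v × Unique q × length q ≤ length p × q ⊑ p
  remove-loops [] = [] , [] , [] , z≤n , id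
  remove-loops (_∷_ {w = w} e W) with remove-loops W
  ... | q , W′ , u , le , sub with w ∈? q
  ...   | no w∉q  = w ∷ q , e ∷ W′ , unique-∷ w∉q u , s≤s le ,
                    λ { (here eq) → here eq ; (there x∈) → there (sub x∈) }
  ...   | yes w∈q =
    let r , W″ , u″ , le″ , sub″ = cut-at W′ u w∈q
    in w ∷ r , e ∷ W″ , u″ , m≤n⇒m≤1+n (≤-trans le″ le) , there ∘ sub ∘ sub″

  record LongPath (S : VSet n) (m : ℕ) : Set where
    field
      {first last} : Fin n
      {rest}       : List (Fin n)
      walk         : Walk E first rest last
      unique       : Unique (first ∷ rest)
      inside       : ∀ {v} → v ∈ first ∷ rest → S v ≡ true
      size         : length rest ≡ m

  grow : ∀ {S : VSet n} f {k} → LongPath S k →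
         LongPath S (f + k) ⊎ ∃ λ u → S u ≡ true × card (S ∩ (λ w → E w u)) ≤ f + k
  grow zero    P = inj₁ P
  grow {S} (suc f) {k} P with find ((S ∩ λ w → E w first) ∖ ⟨ first ∷ rest ⟩)
    where open LongPath P
  ... | inj₁ (w , h) = subst (λ m → LongPath S m ⊎ ∃ λ u → S u ≡ true × card (S ∩ (λ w → E w u)) ≤ m)
    (+-suc f k) (grow f (record
      { walk   = ∧-elimʳ {S w} (∧-elimˡ h) ∷ walk
      ; unique = unique-∷ (not-elim (∧-elimʳ {S w ∧ E w first} h) ∘ ∈⇒⟨⟩) unique
      ; inside = λ { (here refl) → ∧-elimˡ (∧-elimˡ h) ; (there v∈) → inside v∈ }
      ; size   = cong suc size }))
    where open LongPath P
  -- Stuck: all in-neighbours in `S` of the first vertex lie on the path, which has `1 + k` vertices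
  -- because `rest` omits the first one. The round still to be made supplies this 1.
  ... | inj₂ none = inj₂ (first , inside (here refl) ,
    ≤-trans (card-mono {B = ⟨ first ∷ rest ⟩} λ w h → [ id , (λ w∉ → ⊥-elim (none w (∧-intro h (not-intro w∉)))) ]′ (true? _))
    (≤-trans (card-⟨⟩ (first ∷ rest)) (s≤s (≤-trans (≤-reflexive size) (m≤n+m k f)))))
    where open LongPath P

  -- The first vertex of a path that cannot be extended backwards has at most m
  -- in-neighbours; deleting these edges turns it into a source.
  long-path-or-cert : (∀ v → E v v ≡ false) → ∀ m (S : VSet n) →
                      LongPath S m ⊎ ∃ λ c → bad c E S ≤ m * card S
  long-path-or-cert noLoop m S = by-size (card S) S ≤-refl
    where
    empty : ∀ {S} → (∀ v → ¬ (S v ≡ true)) → ∃ λ c → bad c E S ≤ m * card S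
    empty {S} none = trivial-cert , ≤-trans (bad≤card² trivial-cert E S)
      (≤-trans (≤-reflexive (cong (_* card S) (card-empty none))) z≤n)
    by-size : ∀ s S → card S ≤ s → LongPath S m ⊎ ∃ λ c → bad c E S ≤ m * card S
    by-size zero    S le = inj₂ (empty λ v h → <-irrefl refl (≤-trans (card-pos v h) le))
    by-size (suc s) S le with find S
    ... | inj₂ none     = inj₂ (empty none)
    ... | inj₁ (v , sv) with grow {S} m {0} (record
      { walk = [] {u = v} ; unique = unique-∷ (λ ()) [] ; inside = λ { (here refl) → sv } ; size = refl })
    ...   | inj₁ P = inj₁ (subst (LongPath S) (+-identityʳ m) P)
    ...   | inj₂ (u , su , indeg) = finish (by-size s T (≤-pred (≤-trans (card-except< S u su) le)))
      where
      A T : VSet n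
      A = except u
      T = S ∩ A
      -- `S ∖ A` is just `u`, and `u` has no loop.
      none-inside : ∀ c → bad c E (S ∖ A) ≡ 0
      none-inside c = n≤0⇒n≡0 (≤-trans (card₂-rows≤ {A = S ∖ A} {0} (λ _ _ → ∧-elimˡ) λ w w∈ →
        ≤-reflexive (card-empty λ v h → let _ , v∈ , e , _ = bad-elim c E (S ∖ A) w v h in
          case trans (sym (subst₂ (λ x y → E x y ≡ true) (∖except S u w w∈) (∖except S u v v∈) e)) (noLoop u) of λ ())) z≤n)
      finish : LongPath T m ⊎ (∃ λ c → bad c E T ≤ m * card T) → LongPath S m ⊎ ∃ λ c → bad c E S ≤ m * card S
      finish (inj₁ P) = inj₁ (record { LongPath P ; inside = λ v∈ → ∧-elimˡ (LongPath.inside P v∈) })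
      finish (inj₂ (c , h)) = inj₂ (combine A c trivial-cert ,
        ≤-trans (bad-combine E S A c trivial-cert) (≤-trans (+-mono-≤ (+-mono-≤ h (≤-reflexive (none-inside trivial-cert)))
          (≤-trans (edges-except S u E) (≤-trans indeg (≤-reflexive (+-identityʳ m)))))
        (≤-trans (≤-reflexive (arith m (card T))) (*-monoʳ-≤ m (card-except< S u su)))))
        where
        arith : ∀ m t → m * t + 0 + m ≡ m * suc t
        arith = solve-∀

-- Expanding sets

has : ∀ {n} → VSet n → Bool
has A = [ (λ _ → true) , (λ _ → false) ]′ (find A)

has-intro : ∀ {n} (A : VSet n) {v} → A v ≡ true → has A ≡ true
has-intro A {v} h with find A
... | inj₁ _    = refl
... | inj₂ none = ⊥-elim (none v h)

has-elim : ∀ {n} (A : VSet n) → has A ≡ true → ∃ λ v → A v ≡ true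
has-elim A h with find A
... | inj₁ w = w

-- Multiplied out: every directed cut of `S` into two nonempty parts has edge density above 1/K.
Expanding : ∀ {n} → Adj n → ℕ → VSet n → Set
Expanding E K S = ∀ A → 0 < card (S ∩ A) → 0 < card (S ∖ A) →
  card (S ∩ A) * card (S ∖ A) < K * edges E (S ∩ A) (S ∖ A)

-- Reversing the edges turns the cut at `A` into the cut at the complement of `A`, while the product
-- of the two sizes stays the same.
expanding-flip : ∀ {n} {E : Adj n} {K S} → Expanding E K S → Expanding (flip E) K S
expanding-flip {E = E} {K} {S} exp A 0<∩ 0<∖ =
  ≤-trans (s≤s (≤-trans (≤-reflexive (*-comm (card (S ∩ A)) _)) (*-monoʳ-≤ (card (S ∖ A)) (card-mono ∩⇒∖))))
  (≤-trans (exp (not ∘ A) 0<∖ (≤-trans 0<∩ (card-mono ∩⇒∖)))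
  (*-monoʳ-≤ K (≤-trans (card₂-mono {Q = λ u v → (S ∖ A) u ∧ (S ∩ A) v ∧ E u v} λ u v h → ∧-intro (∧-elimˡ {(S ∖ A) u} h)
      (∧-intro (∖⇒∩ v (∧-elimˡ (∧-elimʳ {(S ∖ A) u} h))) (∧-elimʳ {(S ∖ (not ∘ A)) v} (∧-elimʳ {(S ∖ A) u} h))))
    (≤-trans (≤-reflexive (card₂-swap λ u v → (S ∖ A) u ∧ (S ∩ A) v ∧ E u v))
      (card₂-mono {Q = λ u v → (S ∩ A) u ∧ (S ∖ A) v ∧ E v u} λ u v h → ∧-intro (∧-elimˡ {(S ∩ A) u} (∧-elimʳ {(S ∖ A) v} h))
        (∧-intro (∧-elimˡ {(S ∖ A) v} h) (∧-elimʳ {(S ∩ A) u} (∧-elimʳ {(S ∖ A) v} h))))))))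
  where
  ∩⇒∖ : S ∩ A ⊆ᵥ S ∖ (not ∘ A)
  ∩⇒∖ v h = ∧-intro (∧-elimˡ h) (not-intro λ a → not-elim a (∧-elimʳ {S v} h))
  ∖⇒∩ : S ∖ (not ∘ A) ⊆ᵥ S ∩ A
  ∖⇒∩ v h = ∧-intro (∧-elimˡ h) (case true? (A v) of λ
    { (inj₁ a) → a ; (inj₂ a) → ⊥-elim (not-elim (∧-elimʳ {S v} h) (not-intro a)) })

-- Expansion across the cut that separates `v` from the rest: the cut edges are those entering `v`,
-- the product is at least |S| - 1, and the strict inequality makes up for the lost vertex.
indegree : ∀ {n} {E : Adj n} {K S} → Expanding E K S → 2 ≤ card S → ∀ {v} → S v ≡ true →
           card S ≤ K * card (S ∩ λ x → E x v)
indegree {E = E} {K} {S} exp 2≤ {v} sv =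
  ≤-trans (card≤1+except S v) (≤-trans (s≤s (≤-trans (≤-reflexive (sym (*-identityʳ _)))
    (*-monoʳ-≤ (card (S ∩ except v)) 0<v)))
  (≤-trans (exp (except v) (≤-pred (≤-trans 2≤ (card≤1+except S v))) 0<v)
    (*-monoʳ-≤ K (edges-except S v E))))
  where
  0<v : 0 < card (S ∖ except v)
  0<v = card-pos v (∖except-self S v sv)

Free : ∀ {n} → VSet n → List (Fin n) → Fin n → Set
Free S Z v = S v ≡ true × v ∉ Z

-- Only the interior has to avoid `Z`, so `Z` may contain the ends; this is how a link is kept from
-- passing through its own ends.
record Link {n} (E : Adj n) (S : VSet n) (D : ℕ) (Z : List (Fin n)) (u v : Fin n) : Set where
  field
    interior : List (Fin n)
    walk     : Walk E u (interior ∷ʳ v) v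
    unique   : Unique interior
    free     : ∀ {x} → x ∈ interior → Free S Z x
    short    : length interior ≤ D

module Connect {n} {E : Adj n} {K : ℕ} {S : VSet n} (0<K : 0 < K) (exp : Expanding E K S) (2≤S : 2 ≤ card S) where

  D : ℕ
  D = 2 * (K * K)

  module _ (Z : List (Fin n)) (small : D * length Z ≤ card S) {u v : Fin n}
           (su : S u ≡ true) (sv : S v ≡ true) where

    -- Breadth-first search from `u` in which every vertex after `u` avoids `Z`; `u` itself may lie
    -- in `Z`.
    ball : ℕ → VSet n
    ball zero    w = single u w
    ball (suc i) w = ball i w ∨ ((S ∖ ⟨ Z ⟩) w ∧ has (ball i ∩ λ x → E x w))

    ball⊆S : ∀ i → ball i ⊆ᵥ S
    ball⊆S zero    w h = subst (λ w → S w ≡ true) (sym (does-elim (w Fin.≟ u) h)) su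
    ball⊆S (suc i) w h with ∨-elim {ball i w} h
    ... | inj₁ b = ball⊆S i w b
    ... | inj₂ s = ∧-elimˡ (∧-elimˡ s)

    start∈ : ∀ i → ball i u ≡ true
    start∈ zero    = does-intro (u Fin.≟ u) refl
    start∈ (suc i) = ∨-introˡ (start∈ i)

    reach : ∀ i w → ball i w ≡ true → Σ (List (Fin n)) λ p →
            Walk E u p w × (∀ {x} → x ∈ p → Free S Z x) × length p ≤ i
    reach zero w h with does-elim (w Fin.≟ u) h
    ... | refl = [] , [] , (λ ()) , z≤n
    reach (suc i) w h with ∨-elim {ball i w} h
    ... | inj₁ b = let p , W , f , le = reach i w b in p , W , f , m≤n⇒m≤1+n le
    ... | inj₂ s =
      let x , xw = has-elim (ball i ∩ λ x → E x w) (∧-elimʳ {(S ∖ ⟨ Z ⟩) w} s)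
          p , W , f , le = reach i x (∧-elimˡ xw)
          sw = ∧-elimˡ {(S ∖ ⟨ Z ⟩) w} s
      in p ∷ʳ w , W +++ (∧-elimʳ {ball i x} xw ∷ []) ,
         (λ x∈ → case ∈-++⁻ p x∈ of λ
           { (inj₁ x∈p) → f x∈p
           ; (inj₂ (here refl)) → ∧-elimˡ sw , not-elim (∧-elimʳ {S w} sw) ∘ ∈⇒⟨⟩ }) ,
         ≤-trans (≤-reflexive (trans (length-++ p) (+-comm (length p) 1))) (s≤s le)

    finish : ∀ i x → i ≤ D → ball i x ∧ E x v ≡ true → Link E S D Z u v
    finish i x i≤D h =
      let p , W , f , le = reach i x (∧-elimˡ h)
          q , W′ , uq , le′ , sub = remove-loops W
      in record
        { interior = q ; walk = W′ +++ (∧-elimʳ {ball i x} h ∷ []) ; unique = uq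
        ; free = f ∘ sub ; short = ≤-trans le′ (≤-trans le i≤D) }

    -- As long as no edge leads from the ball to v, the at least |S|/K in-neighbours of v lie
    -- outside the ball, so that by expansion the next ball gains at least |S|/D vertices.
    module _ i (none : ∀ x → ¬ (ball i x ∧ E x v ≡ true)) where
      N T : VSet n
      N = ball i
      T = ball (suc i) ∖ N

      0<N : 0 < card (S ∩ N)
      0<N = card-pos u (∧-intro su (start∈ i))

      ∈-outside : card S ≤ K * card (S ∖ N)
      ∈-outside = ≤-trans (indegree {E = E} {K} {S} exp 2≤S sv) (*-monoʳ-≤ K (card-mono {A = S ∩ λ x → E x v} {S ∖ N} λ x h →
        ∧-intro (∧-elimˡ h) (not-intro λ b → none x (∧-intro b (∧-elimʳ {S x} h)))))

      0<outside : 0 < card (S ∖ N)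
      0<outside = n≢0⇒n>0 λ eq → <-irrefl refl (≤-trans (≤-trans (s≤s z≤n) 2≤S)
        (≤-trans ∈-outside (≤-reflexive (trans (cong (K *_) eq) (*-zeroʳ K)))))

      leaving : edges E (S ∩ N) (S ∖ N) ≤ (card T + length Z) * card (S ∩ N)
      -- An out-neighbour outside the ball is in the next ball unless `Z` blocks it.
      leaving = card₂-rows≤ {A = S ∩ N} (λ _ _ → ∧-elimˡ) λ x x∈ →
        ≤-trans (card-∪ {B = T} {⟨ Z ⟩} λ y h → new x y h) (+-monoʳ-≤ (card T) (card-⟨⟩ Z))
        where
        new : ∀ x y → (S ∩ N) x ∧ (S ∖ N) y ∧ E x y ≡ true → T y ≡ true ⊎ ⟨ Z ⟩ y ≡ true
        new x y h with true? (⟨ Z ⟩ y)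
        ... | inj₁ z = inj₂ z
        ... | inj₂ z = let h′ = ∧-elimʳ {(S ∩ N) x} h ; y∈ = ∧-elimˡ {(S ∖ N) y} h′ in
          inj₁ (∧-intro (∨-introʳ {N y} (∧-intro (∧-intro (∧-elimˡ y∈) (not-intro z))
            (has-intro (N ∩ λ x → E x y) {x} (∧-intro (∧-elimʳ {S x} (∧-elimˡ {(S ∩ N) x} h)) (∧-elimʳ {(S ∖ N) y} h′)))))
            (∧-elimʳ {S y} y∈))

      outside< : card (S ∖ N) < K * (card T + length Z)
      outside< = *-cancelˡ-< (card (S ∩ N)) _ _ (≤-trans (exp N 0<N 0<outside)
        (≤-trans (*-monoʳ-≤ K leaving) (≤-reflexive (rearrange K (card T + length Z) (card (S ∩ N))))))
        where
        rearrange : ∀ k a b → k * (a * b) ≡ b * (k * a)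
        rearrange = solve-∀

      growth : card S ≤ D * card T
      -- Doubling |S| ≤ K²(|T| + |Z|) gives 2|S| ≤ D|T| + D|Z|, and the last term is at most |S|.
      growth = +-cancelʳ-≤ (card S) _ _ (≤-trans (≤-reflexive (double (card S)))
        (≤-trans (*-monoʳ-≤ 2 (≤-trans ∈-outside (*-monoʳ-≤ K (<⇒≤ outside<))))
        (≤-trans (≤-reflexive (rearrange K (card T) (length Z))) (+-monoʳ-≤ (D * card T) small))))
        where
        double : ∀ s → s + s ≡ 2 * s
        double = solve-∀
        rearrange : ∀ k t z → 2 * (k * (k * (t + z))) ≡ 2 * (k * k) * t + 2 * (k * k) * z
        rearrange = solve-∀

      grown : ∀ {s} → s ≤ D * card N → s + card S ≤ D * card (ball (suc i))
      grown h = ≤-trans (+-mono-≤ h growth) (≤-trans (≤-reflexive (sym (*-distribˡ-+ D (card N) (card T))))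
        (*-monoʳ-≤ D (card-disjoint {A = ball (suc i)} {N} {T} (λ _ → ∨-introˡ) (λ _ → ∧-elimˡ)
          λ w w∈ w∈T → not-elim (∧-elimʳ {ball (suc i) w} w∈T) w∈)))

    -- `f` rounds are left. Each failed round adds |S| to the lower bound on `D * card (ball i)`,
    -- which after `D` rounds would exceed `D * card S`.
    search : ∀ f i → f + i ≡ D → D + i * card S ≤ D * card (ball i) → Link E S D Z u v
    search zero    i refl big = ⊥-elim (<-irrefl refl
      (≤-trans (m<n+m (i * card S) (*-mono-≤ {1} {2} (s≤s z≤n) (*-mono-≤ 0<K 0<K)))
      (≤-trans big (*-monoʳ-≤ D (card-mono {A = ball i} (ball⊆S i))))))
    search (suc f) i eq big with find (ball i ∩ λ x → E x v)
    ... | inj₁ (x , h) = finish i x (≤-trans (m≤n+m i (suc f)) (≤-reflexive eq)) h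
    ... | inj₂ none    = search f (suc i) (trans (+-suc f i) eq)
      (≤-trans (≤-reflexive (rearrange D (card S) i)) (grown i none big))
      where
      rearrange : ∀ d s i → d + suc i * s ≡ d + i * s + s
      rearrange = solve-∀

    connect : Link E S D Z u v
    connect = search D 0 (+-identityʳ D)
      (≤-trans (≤-reflexive (trans (+-identityʳ D) (sym (*-identityʳ D)))) (*-monoʳ-≤ D (card-pos u (start∈ 0))))

-- Gadgets

∉-++ˡ : ∀ {n} {x : Fin n} {p q} → x ∉ p ++ q → x ∉ p
∉-++ˡ x∉ = x∉ ∘ ∈-++⁺ˡ

∉-++ʳ : ∀ {n} {x : Fin n} p {q} → x ∉ p ++ q → x ∉ q
∉-++ʳ p x∉ = x∉ ∘ ∈-++⁺ʳ p

∈-∷ʳ⁻ : ∀ {n} {x y : Fin n} p → x ∈ p ∷ʳ y → x ∈ p ⊎ x ≡ y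
∈-∷ʳ⁻ p x∈ with ∈-++⁻ p x∈
... | inj₁ x∈p       = inj₁ x∈p
... | inj₂ (here eq) = inj₂ eq

unique-∷ʳ : ∀ {n} {x : Fin n} {p} → Unique p → x ∉ p → Unique (p ∷ʳ x)
unique-∷ʳ u x∉p = unique-++ u (unique-∷ (λ ()) []) λ { y∈p (here refl) → x∉p y∈p }

length-∷ʳ : ∀ {n} (p : List (Fin n)) x → length (p ∷ʳ x) ≡ suc (length p)
length-∷ʳ p x = trans (length-++ p) (+-comm (length p) 1)

-- A set a ∷ W of vertices, avoiding Z, inside which a and b are joined by paths of
-- length t + i for each i satisfying P.
record Gadget {n} (E : Adj n) (S : VSet n) (Z : List (Fin n)) (L : ℕ) (P : ℕ → Set) : Set where
  field
    a b   : Fin n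
    W     : List (Fin n)
    t     : ℕ
    free  : ∀ {x} → x ∈ a ∷ W → Free S Z x
    a∉W   : a ∉ W
    b∈S   : S b ≡ true
    small : length W ≤ L
    path  : ∀ i → P i → Σ (List (Fin n)) λ p →
            Walk E a p b × Unique p × p ⊑ W × length p ≡ t + i × length p ≤ L

module _ {n} {E : Adj n} {S : VSet n} where

  shrink-avoided : ∀ {Z Z⁺ L P} → Z ⊑ Z⁺ → Gadget E S Z⁺ L P → Gadget E S Z L P
  shrink-avoided sub g = record
    { Gadget g ; free = λ x∈ → let s , x∉ = Gadget.free g x∈ in s , x∉ ∘ sub }

  enlarge : ∀ {Z L L⁺ P} → L ≤ L⁺ → Gadget E S Z L P → Gadget E S Z L⁺ P
  enlarge le g = record
    { Gadget g ; small = ≤-trans (Gadget.small g) le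
    ; path = λ i pi → let p , W , u , sub , eq , ≤L = Gadget.path g i pi in p , W , u , sub , eq , ≤-trans ≤L le }

  shift : ∀ {Z L P Q} s → (∀ i → Q i → P (s + i)) → Gadget E S Z L P → Gadget E S Z L Q
  shift s f g = record
    { Gadget g ; t = Gadget.t g + s
    ; path = λ i qi → let p , W , u , sub , eq , ≤L = Gadget.path g (s + i) (f i qi)
                      in p , W , u , sub , trans eq (sym (+-assoc (Gadget.t g) s i)) , ≤L }

_⊕_ : (ℕ → Set) → (ℕ → Set) → ℕ → Set
(P ⊕ Q) k = Σ ℕ λ i → Σ ℕ λ j → P i × Q j × i + j ≡ k

-- A gadget with lengths Two d is a pair of paths whose lengths differ by d.
Two : ℕ → ℕ → Set
Two d i = i ≡ 0 ⊎ i ≡ d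

module Gadgets {n} {E : Adj n} (noLoop : ∀ v → E v v ≡ false) {S : VSet n} (D B : ℕ)
  (connect : ∀ Z → length Z ≤ B → ∀ {u v} → S u ≡ true → S v ≡ true → Link E S D Z u v) where

  -- A link from the end of `g` to the start of `h` that avoids both gadgets and `Z` joins any path
  -- of one to any path of the other, so the possible lengths add. The type of `h` makes it avoid
  -- `g`, and the budget keeps the set avoided by the link within `B`.
  series : ∀ {Z L L′ P Q} (g : Gadget E S Z L P) →
           Gadget E S ((Gadget.a g ∷ Gadget.W g) ++ Z) L′ Q →
           suc L + suc L′ + length Z ≤ B → Gadget E S Z (L + suc D + L′) (P ⊕ Q)
  series {Z} {L} {L′} {P} {Q} g h budget = record
    { a = G.a ; b = H.b ; W = W ; t = G.t + suc (length c) + H.t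
    ; free = free ; a∉W = a∉W ; b∈S = H.b∈S ; small = small ; path = path }
    where
    module G = Gadget g
    module H = Gadget h
    X Y Z′ : List (Fin n)
    X = G.a ∷ G.W
    Y = H.a ∷ H.W
    Z′ = X ++ Y ++ Z
    link : Link E S D Z′ G.b H.a
    link = connect Z′ (≤-trans (≤-reflexive (trans (length-++ X) (trans (cong (length X +_) (length-++ Y)) (sym (+-assoc (length X) (length Y) (length Z))))))
      (≤-trans (+-monoˡ-≤ (length Z) (+-mono-≤ (s≤s G.small) (s≤s H.small))) budget))
      G.b∈S (proj₁ (H.free (here refl)))
    open Link link using (short; walk) renaming (interior to c; unique to c-unique; free to c-free)
    W : List (Fin n)
    W = G.W ++ (c ∷ʳ H.a) ++ H.W
    c∉X : ∀ {x} → x ∈ c → x ∉ X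
    c∉X x∈ = ∉-++ˡ (proj₂ (c-free x∈))
    c∉Y : ∀ {x} → x ∈ c → x ∉ Y
    c∉Y x∈ = ∉-++ˡ (∉-++ʳ X (proj₂ (c-free x∈)))
    Y∉X : ∀ {x} → x ∈ Y → x ∉ X
    Y∉X x∈ = ∉-++ˡ (proj₂ (H.free x∈))
    new∉X : ∀ {x} → x ∈ (c ∷ʳ H.a) ++ H.W → x ∉ X
    new∉X x∈ with ∈-++⁻ (c ∷ʳ H.a) x∈
    ... | inj₂ x∈W = Y∉X (there x∈W)
    ... | inj₁ x∈c with ∈-∷ʳ⁻ c x∈c
    ...   | inj₁ x∈c′ = c∉X x∈c′
    ...   | inj₂ refl = Y∉X (here refl)
    free : ∀ {x} → x ∈ G.a ∷ W → Free S Z x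
    free (here eq) = G.free (here eq)
    free (there x∈) with ∈-++⁻ G.W x∈
    ... | inj₁ x∈G = G.free (there x∈G)
    ... | inj₂ x∈′ with ∈-++⁻ (c ∷ʳ H.a) x∈′
    ...   | inj₂ x∈H = let s , x∉ = H.free (there x∈H) in s , ∉-++ʳ X x∉
    ...   | inj₁ x∈c with ∈-∷ʳ⁻ c x∈c
    ...     | inj₁ x∈c′ = let s , x∉ = c-free x∈c′ in s , ∉-++ʳ Y (∉-++ʳ X x∉)
    ...     | inj₂ refl = let s , x∉ = H.free (here refl) in s , ∉-++ʳ X x∉
    a∉W : G.a ∉ W
    a∉W a∈ with ∈-++⁻ G.W a∈
    ... | inj₁ a∈G = G.a∉W a∈G
    ... | inj₂ a∈′ = new∉X a∈′ (here refl)
    length-joined : ∀ p q → length (p ++ (c ∷ʳ H.a) ++ q) ≡ length p + suc (length c) + length q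
    length-joined p q = trans (length-++ p) (trans (cong (length p +_) (trans (length-++ (c ∷ʳ H.a))
      (cong (_+ length q) (length-∷ʳ c H.a)))) (sym (+-assoc (length p) _ _)))
    small : length W ≤ L + suc D + L′
    small = ≤-trans (≤-reflexive (length-joined G.W H.W)) (+-mono-≤ (+-mono-≤ G.small (s≤s short)) H.small)
    path : ∀ k → (P ⊕ Q) k → Σ (List (Fin n)) λ p →
           Walk E G.a p H.b × Unique p × p ⊑ W × length p ≡ G.t + suc (length c) + H.t + k × length p ≤ L + suc D + L′
    path _ (i , j , pi , qj , refl) =
      let p , V , u , p⊑ , eq , ≤L = G.path i pi
          q , V′ , u′ , q⊑ , eq′ , ≤L′ = H.path j qj
      in p ++ (c ∷ʳ H.a) ++ q , V +++ walk +++ V′ ,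
         unique-++ u (unique-++ (unique-∷ʳ c-unique λ a∈ → c∉Y a∈ (here refl)) u′
           (λ x∈ x∈q → case ∈-∷ʳ⁻ c x∈ of λ
             { (inj₁ x∈c) → c∉Y x∈c (there (q⊑ x∈q)) ; (inj₂ refl) → H.a∉W (q⊑ x∈q) }))
           (λ x∈p x∈ → new∉X ([ ∈-++⁺ˡ , (λ x∈q → ∈-++⁺ʳ (c ∷ʳ H.a) (q⊑ x∈q)) ]′ (∈-++⁻ (c ∷ʳ H.a) x∈)) (there (p⊑ x∈p))) ,
         (λ x∈ → case ∈-++⁻ p x∈ of λ
           { (inj₁ x∈p) → ∈-++⁺ˡ (p⊑ x∈p)
           ; (inj₂ x∈′) → ∈-++⁺ʳ G.W ([ ∈-++⁺ˡ , (λ x∈q → ∈-++⁺ʳ (c ∷ʳ H.a) (q⊑ x∈q)) ]′ (∈-++⁻ (c ∷ʳ H.a) x∈′)) }) ,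
         trans (length-joined p q) (trans (cong₂ _+_ (cong (_+ suc (length c)) eq) eq′)
           (rearrange G.t i (suc (length c)) H.t j)) ,
         ≤-trans (≤-reflexive (length-joined p q)) (+-mono-≤ (+-mono-≤ ≤L (s≤s short)) ≤L′)
      where
      rearrange : ∀ t i c t′ j → t + i + c + (t′ + j) ≡ t + c + t′ + (i + j)
      rearrange = solve-∀

-- At level 0 a gadget consists of two routes of at most `2 + D` vertices each; the next level joins
-- two gadgets by a link.
width : ℕ → ℕ → ℕ
width D zero    = 2 * (2 + D)
width D (suc j) = width D j + suc D + width D j

-- Room that the avoided set must leave below `κ`: the second gadget of level `j` has to avoid the
-- first, and the link between them has to avoid both.
reserve : ℕ → ℕ → ℕ
reserve D zero    = 0
reserve D (suc j) = reserve D j + (suc (width D j) + suc (width D j))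

chain-width : ℕ → ℕ → ℕ → ℕ
chain-width D J zero    = 0
chain-width D J (suc m) = width D J + suc D + chain-width D J m

chain-reserve : ℕ → ℕ → ℕ → ℕ
chain-reserve D J zero    = reserve D J
chain-reserve D J (suc m) = chain-reserve D J m + (suc (width D J) + suc (chain-width D J m))

-- Abundant length differences and the Euclidean descent

module Abundance {n} {E : Adj n} (noLoop : ∀ v → E v v ≡ false) {S : VSet n} (D κ B : ℕ)
  (κ-budget : 3 + (3 + D) * κ ≤ B)
  (connect : ∀ Z → length Z ≤ B → ∀ {u v} → S u ≡ true → S v ≡ true → Link E S D Z u v)
  (fresh : ∀ Z → length Z ≤ B → ∃ (Free S Z))
  (no-cert : ∀ Z → length Z ≤ B → ∀ c → ¬ (∀ u v → Free S Z u → Free S Z v → E u v ≡ true → OK c u v))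
  where

  open Gadgets noLoop D B connect

  κ≤B : κ ≤ B
  κ≤B = ≤-trans (m≤m+n κ _) (≤-trans (m≤n+m ((3 + D) * κ) 3) κ-budget)

  -- Gadgets for an abundant difference survive the loss of any few vertices and so can be chosen
  -- disjoint. The double negation lets `kill` extract, from a failure of abundance, a small set met
  -- by all gadgets of that difference.
  Abundant : ℕ → ℕ → Set
  Abundant j d = ∀ Z → length Z + reserve D j ≤ κ → ¬ ¬ Gadget E S Z (width D j) (Two d)

  width-mono : ∀ j → width D j ≤ width D (suc j)
  width-mono j = ≤-trans (m≤m+n _ (suc D)) (m≤m+n _ (width D j))

  width₀≤ : ∀ j → width D 0 ≤ width D j
  width₀≤ zero    = ≤-refl
  width₀≤ (suc j) = ≤-trans (width₀≤ j) (width-mono j)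

  abundant-suc : ∀ {j d} → Abundant j d → Abundant (suc j) d
  abundant-suc {j} h Z le k = h Z (≤-trans (+-monoʳ-≤ (length Z) (m≤m+n (reserve D j) _)) le)
    (k ∘ enlarge (width-mono j))

  abundant-+ : ∀ {j d} k → Abundant j d → Abundant (k + j) d
  abundant-+ zero    h = h
  abundant-+ {j} (suc k) h = abundant-suc {k + j} (abundant-+ {j} k h)

  second-budget : ∀ {L} (Z W : List (Fin n)) {x r L′} → length W ≤ L → length Z + (r + (suc L + L′)) ≤ κ →
                  length ((x ∷ W) ++ Z) + r ≤ κ
  second-budget {L} Z W {x} {r} {L′} le h = ≤-trans (≤-reflexive (cong (_+ r) (length-++ (x ∷ W))))
    (≤-trans (+-monoˡ-≤ r (+-monoˡ-≤ (length Z) (s≤s le)))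
    (≤-trans (m≤m+n _ L′) (≤-trans (≤-reflexive (rearrange (suc L) (length Z) r L′)) h)))
    where
    rearrange : ∀ a b c d → a + b + c + d ≡ b + (c + (a + d))
    rearrange = solve-∀

  series-budget : ∀ {L L′} (Z : List (Fin n)) {r} → length Z + (r + (suc L + suc L′)) ≤ κ →
                  suc L + suc L′ + length Z ≤ B
  series-budget {L} {L′} Z {r} h = ≤-trans (≤-trans (m≤m+n _ r) (≤-trans
    (≤-reflexive (rearrange (suc L + suc L′) (length Z) r)) h)) κ≤B
    where
    rearrange : ∀ a b c → a + b + c ≡ b + (c + a)
    rearrange = solve-∀

  -- Of two gadgets in series, take the long path of one and the short path of the other.
  abundant-∸ : ∀ {j b r} → Abundant j (b + r) → Abundant j b → Abundant (suc j) r
  abundant-∸ {j} {b} {r} hbr hb Z le k =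
    hbr Z (≤-trans (+-monoʳ-≤ (length Z) (m≤m+n (reserve D j) _)) le) λ g →
    hb (Gadget.a g ∷ Gadget.W g ++ Z) (second-budget Z (Gadget.W g) {Gadget.a g} (Gadget.small g) le) λ h →
    k (shift b f (series g h (series-budget Z {reserve D j} le)))
    where
    f : ∀ i → Two r i → (Two (b + r) ⊕ Two b) (b + i)
    f i (inj₁ refl) = 0 , b , inj₁ refl , inj₂ refl , sym (+-identityʳ b)
    f i (inj₂ refl) = b + r , 0 , inj₂ refl , inj₁ refl , +-identityʳ (b + r)

  -- Subtracts `d` from the difference `k` times, each time at the cost of one level.
  abundant-remainder : ∀ {j d r} k → Abundant j (k * d + r) → Abundant j d → Abundant (k + j) r
  abundant-remainder zero    h _ = h
  abundant-remainder {j} {d} {r} (suc k) h hd = subst (λ i → Abundant i r) (+-suc k j)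
    (abundant-remainder {suc j} {d} k (abundant-∸ {j} {d} (subst (Abundant j) (+-assoc d (k * d) r) h) hd) (abundant-suc {j} hd))

  module _ (j p′ : ℕ) (divisible : ∀ e → e ≤ 2 + D → Abundant j e → (2 + p′) ∣ e) where
    p : ℕ
    p = 2 + p′

    Killed : List (Fin n) → ℕ → Set
    Killed Z e = ¬ (p ∣ e) → ¬ Gadget E S Z (width D j) (Two e)

    -- A non-multiple of `p` is not abundant at level `j`, so at most `κ` vertices meet all its
    -- gadgets; `Z` is the union of these sets over the differences below `m`.
    kill : ∀ m → m ≤ 3 + D → ¬ ¬ Σ (List (Fin n)) λ Z → length Z ≤ m * κ × (∀ e → e < m → Killed Z e)
    kill zero    _  k = k ([] , z≤n , λ _ ())
    kill (suc m) m< k = kill m (<⇒≤ m<) λ (Z , le , h) → extend Z le h (p ∣? m)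
      where
      extend : ∀ Z → length Z ≤ m * κ → (∀ e → e < m → Killed Z e) → Dec (p ∣ m) → ⊥
      extend Z le h (yes p∣m) = k (Z , ≤-trans le (m≤n+m (m * κ) κ) , λ e e< ¬p∣e →
        case m<1+n⇒m<n∨m≡n e< of λ { (inj₁ lt) → h e lt ¬p∣e ; (inj₂ refl) → ⊥-elim (¬p∣e p∣m) })
      extend Z le h (no ¬p∣m) = ¬p∣m (divisible m (≤-pred m<) λ Z′ le′ none →
        k (Z′ ++ Z , ≤-trans (≤-reflexive (length-++ Z′)) (+-mono-≤ (≤-trans (m≤m+n _ _) le′) le) , λ e e< ¬p∣e →
          case m<1+n⇒m<n∨m≡n e< of λ
            { (inj₁ lt)   → h e lt ¬p∣e ∘ shrink-avoided (∈-++⁺ʳ Z′)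
            ; (inj₂ refl) → none ∘ shrink-avoided ∈-++⁺ˡ }))

    -- Z meets every gadget with a difference not divisible by p, so the residue of the length of
    -- a path from x to v depends on v alone; it is the potential φ that certifies periodicity.
    module Potential (Z : List (Fin n)) (Z≤ : length Z ≤ (3 + D) * κ)
                     (killed : ∀ e → e < 3 + D → Killed Z e) where
      Z≤B : length Z ≤ B
      Z≤B = ≤-trans (≤-trans Z≤ (m≤n+m _ 3)) κ-budget

      x : Fin n
      x = proj₁ (fresh Z Z≤B)

      x-free : Free S Z x
      x-free = proj₂ (fresh Z Z≤B)

      x∷Z : List (Fin n)
      x∷Z = x ∷ Z

      -- A link from `x` has at most `D + 1` edges, and one more edge may be appended. So two routes
      -- differ in length by at most `2 + D`, the range in which differences have been killed.
      record Route (v : Fin n) : Set where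
        field
          list   : List (Fin n)
          walk   : Walk E x list v
          unique : Unique list
          free   : ∀ {w} → w ∈ list → Free S x∷Z w
          end∈S  : S v ≡ true
          short  : length list ≤ 2 + D

      -- Otherwise the two routes together would be a gadget of a killed difference.
      switch : ∀ {v} (R Q : Route v) → length (Route.list R) ≤ length (Route.list Q) →
               p ∣ (length (Route.list Q) ∸ length (Route.list R))
      switch {v} R Q le with p ∣? (length (Route.list Q) ∸ length (Route.list R))
      ... | yes p∣e = p∣e
      ... | no ¬p∣e = ⊥-elim (killed e (s≤s (≤-trans (m∸n≤m _ (length R.list)) Q.short)) ¬p∣e (record
        { a = x ; b = v ; W = R.list ++ Q.list ; t = length R.list
        ; free = λ
            { (here refl) → x-free
            ; (there w∈) → let s , w∉ = [ R.free , Q.free ]′ (∈-++⁻ R.list w∈) in s , w∉ ∘ there }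
        ; a∉W = λ x∈ → proj₂ ([ R.free , Q.free ]′ (∈-++⁻ R.list x∈)) (here refl)
        ; b∈S = R.end∈S
        ; small = ≤-trans (≤-reflexive (length-++ R.list)) (≤-trans (+-mono-≤ R.short Q.short)
            (≤-trans (≤-reflexive (cong (2 + D +_) (sym (+-identityʳ (2 + D))))) (width₀≤ j)))
        ; path = λ
            { _ (inj₁ refl) → R.list , R.walk , R.unique , ∈-++⁺ˡ , sym (+-identityʳ _) , short≤ R.short
            ; _ (inj₂ refl) → Q.list , Q.walk , Q.unique , ∈-++⁺ʳ R.list , sym (m+[n∸m]≡n le) , short≤ Q.short } }))
        where
        module R = Route R
        module Q = Route Q
        e : ℕ
        e = length Q.list ∸ length R.list
        short≤ : ∀ {l} → l ≤ 2 + D → l ≤ width D j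
        short≤ h = ≤-trans h (≤-trans (m≤m+n (2 + D) _) (width₀≤ j))

      same-residue : ∀ {v} (R Q : Route v) → length (Route.list R) % p ≡ length (Route.list Q) % p
      same-residue R Q with ≤-total (length (Route.list R)) (length (Route.list Q))
      ... | inj₁ le = sym (∣-∣⇒% (length (Route.list Q)) (length (Route.list R)) p (subst (p ∣_) (sym (m≤n⇒∣n-m∣≡n∸m le)) (switch R Q le)))
      ... | inj₂ le = ∣-∣⇒% (length (Route.list R)) (length (Route.list Q)) p (subst (p ∣_) (sym (m≤n⇒∣n-m∣≡n∸m le)) (switch Q R le))

      -- Avoiding `y` allows an edge to `y` to be appended to the route; in `φ` the vertex `y` is
      -- `v` itself. The vertices `y`, `v` and `x` on top of `Z` account for the 3 in `κ-budget`.
      route-avoiding : ∀ y {v} → Free S x∷Z v → Σ (Route v) λ R →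
                       (length (Route.list R) ≤ suc D) × (y ∈ Route.list R → y ≡ v)
      route-avoiding y {v} v-free = record
        { list = c ∷ʳ v ; walk = walk ; unique = unique-∷ʳ unique λ v∈ → proj₂ (free v∈) (there (here refl))
        ; free = λ w∈ → case ∈-∷ʳ⁻ c w∈ of λ
           { (inj₁ w∈c) → let s , w∉ = free w∈c in s , w∉ ∘ there ∘ there ; (inj₂ refl) → v-free }
        ; end∈S = proj₁ v-free
        ; short = m≤n⇒m≤1+n len } , len , λ y∈ → case ∈-∷ʳ⁻ c y∈ of λ
           { (inj₁ y∈c) → ⊥-elim (proj₂ (free y∈c) (here refl)) ; (inj₂ eq) → eq }
        where
        link : Link E S D (y ∷ v ∷ x∷Z) x v
        link = connect (y ∷ v ∷ x∷Z) (≤-trans (+-monoʳ-≤ 3 Z≤) κ-budget) (proj₁ x-free) (proj₁ v-free)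
        open Link link renaming (interior to c)
        len : length (c ∷ʳ v) ≤ suc D
        len = ≤-trans (≤-reflexive (length-∷ʳ c v)) (s≤s short)

      extend : ∀ {u v} → Free S x∷Z u → Free S x∷Z v → E u v ≡ true → Σ (Route u) λ R → Σ (Route v) λ Q →
               length (Route.list Q) ≡ suc (length (Route.list R))
      extend {u} {v} uf vf e with route-avoiding v uf
      ... | R , len , v∈⇒ = R , record
        { list = list ∷ʳ v ; walk = walk +++ (e ∷ [])
        -- If `v` were on the route it would be its end `u`, and the edge a loop.
        ; unique = unique-∷ʳ unique λ v∈ → case trans (sym e) (subst (λ w → E w v ≡ false) (v∈⇒ v∈) (noLoop v)) of λ ()
        ; free = λ w∈ → case ∈-∷ʳ⁻ list w∈ of λ { (inj₁ w∈R) → free w∈R ; (inj₂ refl) → vf }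
        ; end∈S = proj₁ vf
        ; short = ≤-trans (≤-reflexive (length-∷ʳ list v)) (s≤s len) } , length-∷ʳ list v
        where open Route R

      free? : ∀ v → Dec (Free S x∷Z v)
      free? v = (S v ≟ᵇ true) ×-dec ¬? (v ∈? x∷Z)

      φ : Fin n → ℕ
      φ v with free? v
      ... | yes f = length (Route.list (proj₁ (route-avoiding v f)))
      ... | no _  = 0

      φ-residue : ∀ {v} → Free S x∷Z v → (R : Route v) → length (Route.list R) % p ≡ φ v % p
      φ-residue {v} f R with free? v
      ... | yes f′ = same-residue R (proj₁ (route-avoiding v f′))
      ... | no ¬f  = ⊥-elim (¬f f)

      contradiction : ⊥
      contradiction = no-cert x∷Z (≤-trans (s≤s Z≤) (≤-trans (+-monoˡ-≤ ((3 + D) * κ) {1} {3} (s≤s z≤n)) κ-budget))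
        (record { rank = λ _ → 0 ; per = λ _ → p′ ; φ = φ }) λ u v uf vf e →
          let R , Q , eq = extend uf vf e
          in inj₂ (refl , refl , trans (%-suc (φ u) (length (Route.list R)) p (sym (φ-residue uf R)))
            (trans (cong (_% p) (sym eq)) (φ-residue vf Q)))

    not-all-divisible : ⊥
    not-all-divisible = kill (3 + D) ≤-refl λ (Z , Z≤ , killed) → Potential.contradiction Z Z≤ killed

  stride : ℕ
  stride = 2 + D

  -- For d ≥ 2, taking `d` itself as the modulus gives an abundant e ≤ 2 + D that is not a multiple
  -- of `d`; its remainder is then abundant, positive and smaller. The level rises by e / d, padded
  -- to exactly `stride` so that the final level does not depend on the remainders met.
  descend : ∀ g {j d} → 1 ≤ d → d ≤ g → d ≤ 2 + D → Abundant j d → ¬ ¬ Abundant (g * stride + j) 1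
  descend (suc g) {j} {suc zero}     _ _ _ h k = k (abundant-+ {j} (suc g * stride) h)
  descend (suc g) {j} {d@(suc (suc d′))} _ d≤g d≤ h k = not-all-divisible j d′ divisible
    where
    divisible : ∀ e → e ≤ 2 + D → Abundant j e → d ∣ e
    divisible e e≤ he with d ∣? e
    ... | yes d∣e = d∣e
    ... | no ¬d∣e = ⊥-elim (descend g {stride + j} {e % d}
      (n≢0⇒n>0 (¬d∣e ∘ m%n≡0⇒n∣m e d)) (≤-pred (≤-trans (m%n<n e d) d≤g)) (≤-trans (<⇒≤ (m%n<n e d)) d≤)
      (subst (λ i → Abundant i (e % d)) (trans (sym (+-assoc (stride ∸ e / d) (e / d) j)) (cong (_+ j) (m∸n+n≡m (≤-trans (m/n≤m e d) e≤))))
        (abundant-+ {e / d + j} (stride ∸ e / d) (abundant-remainder {j} {d} (e / d)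
          (subst (Abundant j) (trans (m≡m%n+[m/n]*n e d) (+-comm (e % d) _)) he) h)))
      (k ∘ subst (λ i → Abundant i 1) (trans (sym (+-assoc (g * stride) stride j)) (cong (_+ j) (+-comm (g * stride) stride)))))

  J : ℕ
  J = (2 + D) * stride

  -- With modulus 2, some odd and hence positive difference is abundant at level 0; the descent
  -- starts from it.
  unit-abundant : ¬ ¬ Abundant J 1
  unit-abundant k = not-all-divisible 0 0 divisible
    where
    divisible : ∀ e → e ≤ 2 + D → Abundant 0 e → 2 ∣ e
    divisible e e≤ he with 2 ∣? e
    ... | yes 2∣e = 2∣e
    ... | no ¬2∣e = ⊥-elim (descend (2 + D) {0} {e} (n≢0⇒n>0 λ { refl → ¬2∣e (divides 0 refl) }) e≤ e≤ he
      (k ∘ subst (λ i → Abundant i 1) (+-identityʳ J)))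

  -- Each of `m` unit gadgets in series adds 0 or 1 to the length. The chain ends in a single
  -- vertex, joined to itself by the empty path.
  chain : Abundant J 1 → ∀ m Z → length Z + chain-reserve D J m ≤ κ →
          ¬ ¬ Gadget E S Z (chain-width D J m) (_≤ m)
  chain unit zero Z le k =
    let x , xf = fresh Z (≤-trans (≤-trans (m≤m+n _ _) le) κ≤B)
    in k (record
      { a = x ; b = x ; W = [] ; t = 0 ; free = λ { (here refl) → xf } ; a∉W = λ () ; b∈S = proj₁ xf ; small = z≤n
      ; path = λ { zero z≤n → [] , [] , [] , (λ ()) , refl , z≤n } })
  chain unit (suc m) Z le k =
    unit Z (≤-trans (+-monoʳ-≤ (length Z) (≤-trans (reserve≤ m) (m≤m+n _ _))) le) λ g →
    chain unit m (Gadget.a g ∷ Gadget.W g ++ Z) (second-budget Z (Gadget.W g) {Gadget.a g} (Gadget.small g) le) λ h →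
    k (shift 0 split (series g h (series-budget Z {chain-reserve D J m} le)))
    where
    reserve≤ : ∀ m → reserve D J ≤ chain-reserve D J m
    reserve≤ zero    = ≤-refl
    reserve≤ (suc m) = ≤-trans (reserve≤ m) (m≤m+n _ _)
    split : ∀ i → i ≤ suc m → (Two 1 ⊕ (_≤ m)) i
    split zero    _        = 0 , 0 , inj₁ refl , z≤n , refl
    split (suc i) (s≤s i≤) = 1 , i , inj₂ refl , i≤ , refl

  flexible-gadget : ∀ m → chain-reserve D J m ≤ κ → ¬ ¬ Gadget E S [] (chain-width D J m) (_≤ m)
  flexible-gadget m le k = unit-abundant λ unit → chain unit m [] le k

-- Dominating sets

module Dominate {n} (F : Fin n → Fin n → Bool) {S : VSet n} {K q : ℕ} (0<K : 0 < K) (2≤S : 2 ≤ card S)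
  (degree : ∀ {y} → S y ≡ true → card S ≤ K * card (S ∩ F y)) (S≤Kq : card S ≤ K * q)
  (Z : List (Fin n)) (Z-small : 2 * K * length Z ≤ card S) where

  undominated : List (Fin n) → VSet n
  undominated R = S ∖ λ y → has (⟨ R ⟩ ∩ F y)

  -- With `U` the undominated set: while 8|U| exceeds `q`, a popular vertex dominates at least
  -- |U|/2K, hence q/16K and so |S|/16K² new vertices.
  rounds : ℕ
  rounds = 16 * (K * K)

  X : VSet n
  X = S ∖ ⟨ Z ⟩

  -- `Z` has at most |S|/2K vertices, half of what the degree condition guarantees.
  degree-X : ∀ {y} → S y ≡ true → card S ≤ 2 * K * card (X ∩ F y)
  degree-X {y} sy = +-cancelʳ-≤ (card S) _ _ (≤-trans (≤-reflexive (double (card S)))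
    (≤-trans (*-monoʳ-≤ 2 (≤-trans (degree sy) (*-monoʳ-≤ K (≤-trans (card-∪ {B = X ∩ F y} {⟨ Z ⟩} split)
      (+-monoʳ-≤ (card (X ∩ F y)) (card-⟨⟩ Z))))))
    (≤-trans (≤-reflexive (rearrange K (card (X ∩ F y)) (length Z))) (+-monoʳ-≤ (2 * K * card (X ∩ F y)) Z-small))))
    where
    double : ∀ s → s + s ≡ 2 * s
    double = solve-∀
    rearrange : ∀ k t z → 2 * (k * (t + z)) ≡ 2 * k * t + 2 * k * z
    rearrange = solve-∀
    split : ∀ r → (S ∩ F y) r ≡ true → (X ∩ F y) r ≡ true ⊎ ⟨ Z ⟩ r ≡ true
    split r h with true? (⟨ Z ⟩ r)
    ... | inj₁ z = inj₂ z
    ... | inj₂ z = inj₁ (∧-intro (∧-intro (∧-elimˡ h) (not-intro z)) (∧-elimʳ {S r} h))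

  -- Double counting of the pairs `y` in `U`, `r` in `X` with `F y r`.
  popular : (U : VSet n) → U ⊆ᵥ S → 0 < card U →
            ∃ λ r → X r ≡ true × card U ≤ 2 * K * card (U ∩ λ y → F y r)
  popular U U⊆S 0<U with find (X ∩ λ r → does (card U ≤? 2 * K * card (U ∩ λ y → F y r)))
  ... | inj₁ (r , h) = r , ∧-elimˡ h , does-elim (card U ≤? _) (∧-elimʳ {X r} h)
  ... | inj₂ none = ⊥-elim (<⇒≱ pred< (*-cancelˡ-≤ (card S) {{>-nonZero (≤-trans (s≤s z≤n) 2≤S)}} average))
    where
    pred< : card U ∸ 1 < card U
    pred< = ∸-monoʳ-< {card U} {1} {0} (s≤s z≤n) 0<U
    M : Fin n → Fin n → Bool
    M y r = U y ∧ X r ∧ F y r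
    lower : card S * card U ≤ 2 * K * card₂ M
    lower = card₂-rows≥* (2 * K) λ y uy → ≤-trans (degree-X (U⊆S y uy))
      (*-monoʳ-≤ (2 * K) (card-mono {A = X ∩ F y} λ r h → ∧-intro uy h))
    -- The failure of popularity is written with `card U ∸ 1` so that it stays strict after
    -- summation over `X`.
    unpopular : ∀ r → X r ≡ true → 2 * K * card (λ y → M y r) ≤ card U ∸ 1
    unpopular r xr = ∸-monoˡ-≤ 1 (≰⇒> λ le → none r (∧-intro xr (does-intro (card U ≤? _)
      (≤-trans le (*-monoʳ-≤ (2 * K) (card-mono {A = λ y → M y r} λ y h →
        ∧-intro (∧-elimˡ h) (∧-elimʳ {X r} (∧-elimʳ {U y} h))))))))
    upper : 2 * K * card₂ M ≤ (card U ∸ 1) * card X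
    upper = ≤-trans (≤-reflexive (cong (2 * K *_) (card₂-swap M)))
      (card₂-rows≤* (2 * K) (λ r y h → ∧-elimˡ (∧-elimʳ {U y} h)) unpopular)
    average : card S * card U ≤ card S * (card U ∸ 1)
    average = ≤-trans lower (≤-trans upper (≤-trans (*-monoʳ-≤ (card U ∸ 1) (card-mono {A = X} λ _ → ∧-elimˡ))
      (≤-reflexive (*-comm (card U ∸ 1) (card S)))))

  -- The greedy choice: each round dominates at least |S| / rounds new vertices.
  record Dominating : Set where
    field
      R       : List (Fin n)
      size    : length R ≤ rounds
      free    : ∀ {r} → r ∈ R → Free S Z r
      few     : 8 * card (undominated R) ≤ q

  search : ∀ f R → f + length R ≡ rounds → (∀ {r} → r ∈ R → Free S Z r) →
           rounds * card (undominated R) + length R * card S ≤ rounds * card S → Dominating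
  search f R eq free inv with 8 * card (undominated R) ≤? q
  ... | yes few = record { R = R ; size = ≤-trans (m≤n+m _ f) (≤-reflexive eq) ; free = free ; few = few }
  search zero R eq free inv | no many = ⊥-elim (many (≤-trans (*-monoʳ-≤ 8 (≤-reflexive none)) z≤n))
    where
    none : card (undominated R) ≡ 0
    none = [ (λ e → ⊥-elim (<-irrefl (sym e) (*-mono-≤ {1} {16} (s≤s z≤n) (*-mono-≤ 0<K 0<K)))) , id ]′
      (m*n≡0⇒m≡0∨n≡0 rounds (n≤0⇒n≡0 (+-cancelʳ-≤ (rounds * card S) _ 0
        (subst (λ l → rounds * card (undominated R) + l * card S ≤ rounds * card S) eq inv))))
  search (suc f) R eq free inv | no many with popular (undominated R) (λ _ → ∧-elimˡ) (n≢0⇒n>0 λ e → many (≤-trans (*-monoʳ-≤ 8 (≤-reflexive e)) z≤n))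
  ... | r , xr , pop = search f (r ∷ R) (trans (+-suc f (length R)) eq)
    (λ { (here refl) → ∧-elimˡ xr , not-elim (∧-elimʳ {S r} xr) ∘ ∈⇒⟨⟩ ; (there r∈) → free r∈ })
    (≤-trans (≤-reflexive (sym (+-assoc (rounds * card U′) (card S) _))) (≤-trans (+-monoˡ-≤ _ progress) inv))
    where
    U U′ : VSet n
    U = undominated R
    U′ = undominated (r ∷ R)
    hit : VSet n
    hit = U ∩ λ y → F y r
    drop : card U′ + card hit ≤ card U
    drop = card-disjoint {A = U} {U′} {hit}
      (λ y h → ∧-intro (∧-elimˡ h) (not-intro λ d → let r′ , h′ = has-elim (⟨ R ⟩ ∩ F y) d in
        not-elim (∧-elimʳ {S y} h) (has-intro (⟨ r ∷ R ⟩ ∩ F y) {r′}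
          (∧-intro (∈⇒⟨⟩ (there (⟨⟩⇒∈ {Z = R} (∧-elimˡ h′)))) (∧-elimʳ {⟨ R ⟩ r′} h′)))))
      (λ _ → ∧-elimˡ)
      (λ y h h′ → not-elim (∧-elimʳ {S y} h) (has-intro (⟨ r ∷ R ⟩ ∩ F y) {r}
        (∧-intro (∈⇒⟨⟩ {Z = r ∷ R} (here refl)) (∧-elimʳ {U y} h′))))
    enough : card S ≤ rounds * card hit
    enough = ≤-trans S≤Kq (≤-trans (*-monoʳ-≤ K (≤-trans (≰⇒≥ many) (*-monoʳ-≤ 8 pop)))
      (≤-reflexive (rearrange K (card hit))))
      where
      rearrange : ∀ k h → k * (8 * (2 * k * h)) ≡ 16 * (k * k) * h
      rearrange = solve-∀
    progress : rounds * card U′ + card S ≤ rounds * card U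
    progress = ≤-trans (+-monoʳ-≤ (rounds * card U′) enough)
      (≤-trans (≤-reflexive (sym (*-distribˡ-+ rounds (card U′) (card hit)))) (*-monoʳ-≤ rounds drop))

  dominate : Dominating
  dominate = search rounds [] (+-identityʳ rounds) (λ ())
    (≤-trans (≤-reflexive (+-identityʳ _)) (*-monoʳ-≤ rounds (card-mono {A = undominated []} λ _ → ∧-elimˡ)))

-- Cycles in expanding sets

-- The interiors for different `r` may intersect, since a cycle will use one arm in each direction.
gather : ∀ {n D} (Lk : Fin n → Set) (interior : ∀ {r} → Lk r → List (Fin n)) →
         (∀ {r} (l : Lk r) → length (interior l) ≤ D) →
         ∀ R → (∀ {r} → r ∈ R → Lk r) → Σ (List (Fin n)) λ W → length W ≤ length R * suc D ×
         (∀ {r} → r ∈ R → Σ (Lk r) λ l → r ∷ interior l ⊑ W)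
gather Lk interior short []      links = [] , z≤n , λ ()
gather Lk interior short (r ∷ R) links =
  let l = links (here refl)
      W , W≤ , h = gather Lk interior short R (links ∘ there)
  in (r ∷ interior l) ++ W ,
     ≤-trans (≤-reflexive (length-++ (r ∷ interior l))) (+-mono-≤ (s≤s (short l)) W≤) ,
     λ { (here refl) → l , ∈-++⁺ˡ
       ; (there r∈)  → let l′ , sub = h r∈ in l′ , ∈-++⁺ʳ (r ∷ interior l) ∘ sub }

-- The gadget must absorb the lengths of the two arms, which are at most D each. The four
-- extra edges of least-length lead into, out of and between the arms and the gadget.
module Constants (K : ℕ) where
  D J slack κ gadget-size arms Ω : ℕ
  D = 2 * (K * K)
  J = (2 + D) * (2 + D)
  slack = D + D
  κ = chain-reserve D J slack
  gadget-size = chain-width D J slack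
  arms = 16 * (K * K) * suc D
  Ω = suc gadget-size + (arms + arms)

  -- B bounds the size of every list of vertices that a connecting path has to avoid.
  opaque
    B : ℕ
    B = 3 + (3 + D) * κ + Ω

    κ-budget : 3 + (3 + D) * κ ≤ B
    κ-budget = m≤m+n _ Ω

    1+Ω≤B : suc Ω ≤ B
    1+Ω≤B = s≤s (m≤n+m Ω (2 + (3 + D) * κ))

  threshold least-length : ℕ
  -- The summand 8 gives 8B ≤ q; `D` and `2 * K` make |S| large enough for linking and for
  -- domination.
  threshold = (8 + D + 2 * K) * B
  least-length = gadget-size + slack + 4

module Core {n} {E : Adj n} (noLoop : ∀ v → E v v ≡ false) {K q ℓ : ℕ} {S : VSet n} (0<K : 0 < K)
  (q-large : Constants.threshold K ≤ q) (q≤S : q ≤ card S) (S≤Kq : card S ≤ K * q)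
  (ℓ-large : Constants.least-length K ≤ ℓ) (expanding : Expanding E K S)
  (no-cert : ∀ c → ¬ (bad c E S ≤ (ℓ + q) * card S)) where

  open Constants K

  8B≤q : 8 * B ≤ q
  8B≤q = ≤-trans (*-monoˡ-≤ B (≤-trans (m≤m+n 8 D) (m≤m+n _ (2 * K)))) q-large

  DB≤S : D * B ≤ card S
  DB≤S = ≤-trans (*-monoˡ-≤ B (≤-trans (m≤n+m D 8) (m≤m+n _ (2 * K)))) (≤-trans q-large q≤S)

  KB≤S : 2 * K * B ≤ card S
  KB≤S = ≤-trans (*-monoˡ-≤ B (m≤n+m (2 * K) (8 + D))) (≤-trans q-large q≤S)

  B<S : B < card S
  B<S = ≤-trans (s≤s (m≤m+n B (6 * B))) (≤-trans (+-monoˡ-≤ (7 * B) {1} {B} (≤-trans (s≤s z≤n) 1+Ω≤B)) (≤-trans 8B≤q q≤S))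

  2≤S : 2 ≤ card S
  2≤S = ≤-trans (s≤s {1} {B} (≤-trans (s≤s z≤n) 1+Ω≤B)) B<S

  connect : ∀ Z → length Z ≤ B → ∀ {u v} → S u ≡ true → S v ≡ true → Link E S D Z u v
  connect Z Z≤ = Connect.connect 0<K expanding 2≤S Z (≤-trans (*-monoʳ-≤ D Z≤) DB≤S)

  fresh : ∀ Z → length Z ≤ B → ∃ (Free S Z)
  fresh Z Z≤ with find (S ∖ ⟨ Z ⟩)
  ... | inj₁ (x , h) = x , ∧-elimˡ h , not-elim (∧-elimʳ {S x} h) ∘ ∈⇒⟨⟩
  ... | inj₂ none    = ⊥-elim (<⇒≱ B<S (≤-trans (card-∖ S ⟨ Z ⟩)
    (≤-trans (+-mono-≤ (≤-reflexive (card-empty {A = S ∖ ⟨ Z ⟩} none)) (card-⟨⟩ Z)) Z≤)))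

  -- The term `q * card S` pays for all pairs that meet `S ∖ T`, so a certificate on `T` would do
  -- for `S`.
  no-cert-on : ∀ T c {k} → bad c E T ≤ k * card S → 2 * card (S ∖ T) ≤ q → k ≤ ℓ → ⊥
  no-cert-on T c {k} bad≤ few k≤ℓ = no-cert c (≤-trans (bad-restrict c E S T)
    (≤-trans (+-mono-≤ (≤-trans bad≤ (*-monoˡ-≤ (card S) k≤ℓ)) (*-monoˡ-≤ (card S) few))
      (≤-reflexive (sym (*-distribʳ-+ (card S) ℓ q)))))

  no-cert-off : ∀ Z → length Z ≤ B → ∀ c → ¬ (∀ u v → Free S Z u → Free S Z v → E u v ≡ true → OK c u v)
  no-cert-off Z Z≤ c ok = no-cert-on T c {0} (≤-reflexive none)
    (≤-trans (*-monoʳ-≤ 2 (≤-trans (card-mono {B = ⟨ Z ⟩} inside) (≤-trans (card-⟨⟩ Z) Z≤)))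
      (≤-trans (*-monoˡ-≤ B {2} {8} (s≤s (s≤s z≤n))) 8B≤q)) z≤n
    where
    T : VSet n
    T = S ∖ ⟨ Z ⟩
    free : ∀ {v} → T v ≡ true → Free S Z v
    free {v} h = ∧-elimˡ h , not-elim (∧-elimʳ {S v} h) ∘ ∈⇒⟨⟩
    inside : S ∖ T ⊆ᵥ ⟨ Z ⟩
    inside v h = [ id , (λ z → ⊥-elim (not-elim (∧-elimʳ {S v} h) (∧-intro (∧-elimˡ h) (not-intro z)))) ]′ (true? _)
    none : bad c E T ≡ 0
    none = n≤0⇒n≡0 (card₂-rows≤ {A = T} {0} (λ _ _ → ∧-elimˡ) λ u _ → ≤-reflexive (card-empty λ v h →
      let tu , tv , e , ¬ok = bad-elim c E T u v h in ¬ok (ok u v (free tu) (free tv) e)))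

  -- Three sets of at most q/8 vertices each make up at most q/2.
  few-enough : ∀ {c r u v} → c ≤ r + (u + v) → r ≤ Ω → 8 * u ≤ q → 8 * v ≤ q → 2 * c ≤ q
  few-enough {c} {r} {u} {v} c≤ r≤ u≤ v≤ = *-cancelˡ-≤ 4 (≤-trans (≤-reflexive (quadruple c))
    (≤-trans (*-monoʳ-≤ 8 c≤) (≤-trans (≤-reflexive (expand r u v))
    (≤-trans (+-mono-≤ (≤-trans (*-monoʳ-≤ 8 (≤-trans r≤ (≤-trans (n≤1+n Ω) 1+Ω≤B))) 8B≤q) (+-mono-≤ u≤ v≤))
    (≤-trans (m≤n+m _ q) (≤-reflexive (four q)))))))
    where
    quadruple : ∀ c → 4 * (2 * c) ≡ 8 * c
    quadruple = solve-∀
    expand : ∀ r u v → 8 * (r + (u + v)) ≡ 8 * r + (8 * u + 8 * v)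
    expand = solve-∀
    four : ∀ q → q + (q + (q + q)) ≡ 4 * q
    four = solve-∀

  -- For out-arms `F` is `E` and the link leads from `r` to the gadget; for in-arms `F` is `flip E`
  -- and it leads from the gadget to `r`. The set `U` holds the few vertices that no chosen `r`
  -- serves.
  record Arms (F : Fin n → Fin n → Bool) (Z : List (Fin n)) (source target : Fin n → Fin n) : Set where
    field
      W     : List (Fin n)
      W≤    : length W ≤ arms
      U     : VSet n
      U-few : 8 * card U ≤ q
      arm   : ∀ {y} → S y ≡ true → ¬ (U y ≡ true) → ∃ λ r → F y r ≡ true × r ∉ Z ×
              Σ (Link E S D (r ∷ Z) (source r) (target r)) λ l → r ∷ Link.interior l ⊑ W

  arms-exist : ∀ F → (∀ {y} → S y ≡ true → card S ≤ K * card (S ∩ F y)) → ∀ Z → suc (length Z) ≤ B →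
               ∀ source target → (∀ {r} → S r ≡ true → S (source r) ≡ true × S (target r) ≡ true) →
               Arms F Z source target
  arms-exist F degree Z 1+Z≤B source target inside = from dominate
    where
    open Dominate F {S} {K} {q} 0<K 2≤S degree S≤Kq Z
      (≤-trans (*-monoʳ-≤ (2 * K) (≤-trans (n≤1+n _) 1+Z≤B)) KB≤S)
    from : Dominating → Arms F Z source target
    from dom = record
      { W = proj₁ arms′ ; W≤ = ≤-trans (proj₁ (proj₂ arms′)) (*-monoˡ-≤ (suc D) size)
      ; U = undominated R ; U-few = few ; arm = arm }
      where
      open Dominating dom
      arms′ = gather (λ r → Link E S D (r ∷ Z) (source r) (target r)) Link.interior Link.short R λ {r} r∈ →
        let s , t = inside (proj₁ (free r∈)) in connect (r ∷ Z) 1+Z≤B s t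
      arm : ∀ {y} → S y ≡ true → ¬ (undominated R y ≡ true) → ∃ λ r → F y r ≡ true × r ∉ Z ×
            Σ (Link E S D (r ∷ Z) (source r) (target r)) λ l → r ∷ Link.interior l ⊑ proj₁ arms′
      arm {y} sy ¬u with true? (has (⟨ R ⟩ ∩ F y))
      ... | inj₂ d = ⊥-elim (¬u (∧-intro sy (not-intro d)))
      ... | inj₁ d = let r , h = has-elim (⟨ R ⟩ ∩ F y) d
                         r∈ = ⟨⟩⇒∈ {Z = R} (∧-elimˡ h)
                     in r , ∧-elimʳ {⟨ R ⟩ r} h , proj₂ (free r∈) , proj₂ (proj₂ arms′) r∈

  FlexibleGadget : Set
  FlexibleGadget = Gadget E S [] gadget-size (_≤ slack)

  module Outgoing (g : FlexibleGadget) where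
    open Gadget g using (a; W; free; small)

    X : List (Fin n)
    X = a ∷ W

    X≤ : length X ≤ suc gadget-size
    X≤ = s≤s small

    1+X≤B : suc (length X) ≤ B
    1+X≤B = ≤-trans (s≤s (≤-trans X≤ (m≤m+n _ (arms + arms)))) 1+Ω≤B

    OutArms : Set
    OutArms = Arms E X id (λ _ → a)

    out-arms : OutArms
    out-arms = arms-exist E (λ sy → indegree {E = flip E} {K} {S} (expanding-flip {E = E} {K} {S} expanding) 2≤S sy)
      X 1+X≤B id (λ _ → a) λ sr → sr , proj₁ (free (here refl))

  module Assemble (g : FlexibleGadget) (out : Outgoing.OutArms g) where
    open Outgoing g using (X; X≤)
    open Gadget g using (a; b; W; t; a∉W; b∈S; path)
    open Arms out using () renaming (W to W⁺; W≤ to W⁺≤; U to U⁺; U-few to few⁺)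

    XW : List (Fin n)
    XW = X ++ W⁺

    XW≤ : length XW ≤ suc gadget-size + arms
    XW≤ = ≤-trans (≤-reflexive (length-++ X)) (+-mono-≤ X≤ W⁺≤)

    1+XW≤B : suc (length XW) ≤ B
    1+XW≤B = ≤-trans (s≤s (≤-trans XW≤ (+-monoʳ-≤ (suc gadget-size) (m≤m+n arms arms)))) 1+Ω≤B

    InArms : Set
    InArms = Arms (flip E) XW (λ _ → b) id

    in-arms : InArms
    in-arms = arms-exist (flip E) (λ sy → indegree {E = E} {K} {S} expanding 2≤S sy)
      XW 1+XW≤B (λ _ → b) id λ sr → b∈S , sr

    module _ (inn : InArms) where
      open Arms inn using () renaming (W to W⁻; W≤ to W⁻≤; U to U⁻; U-few to few⁻)

      reserved : List (Fin n)
      reserved = XW ++ W⁻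

      T : VSet n
      T = S ∖ ⟨ reserved ⟩ ∖ U⁺ ∖ U⁻

      few : 2 * card (S ∖ T) ≤ q
      few = few-enough {card (S ∖ T)} {card ⟨ reserved ⟩} {card U⁺} {card U⁻} (≤-trans (card-∪ {B = ⟨ reserved ⟩} {λ v → U⁺ v ∨ U⁻ v} split)
        (+-monoʳ-≤ (card ⟨ reserved ⟩) (card-∪ {B = U⁺} {U⁻} λ _ → ∨-elim)))
        (≤-trans (card-⟨⟩ reserved) (≤-trans (≤-reflexive (length-++ XW)) (≤-trans (+-mono-≤ XW≤ W⁻≤)
          (≤-reflexive (+-assoc (suc gadget-size) arms arms))))) few⁺ few⁻
        where
        split : ∀ v → (S ∖ T) v ≡ true → ⟨ reserved ⟩ v ≡ true ⊎ U⁺ v ∨ U⁻ v ≡ true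
        split v h with true? (⟨ reserved ⟩ v) | true? (U⁺ v) | true? (U⁻ v)
        ... | inj₁ z | _      | _      = inj₁ z
        ... | _      | inj₁ u | _      = inj₂ (∨-introˡ u)
        ... | _      | _      | inj₁ u = inj₂ (∨-introʳ {U⁺ v} u)
        ... | inj₂ z | inj₂ u | inj₂ w = ⊥-elim (not-elim (∧-elimʳ {S v} h)
          (∧-intro (∧-intro (∧-intro (∧-elimˡ h) (not-intro z)) (not-intro u)) (not-intro w)))

      T⊆S : T ⊆ᵥ S
      T⊆S v h = ∧-elimˡ {S v} (∧-elimˡ (∧-elimˡ h))

      T-free : ∀ {v} → T v ≡ true → v ∉ reserved
      T-free {v} h = not-elim (∧-elimʳ {S v} (∧-elimˡ (∧-elimˡ h))) ∘ ∈⇒⟨⟩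

      T-not⁺ : ∀ {v} → T v ≡ true → ¬ (U⁺ v ≡ true)
      T-not⁺ {v} h = not-elim (∧-elimʳ {(S ∖ ⟨ reserved ⟩) v} (∧-elimˡ h))

      T-not⁻ : ∀ {v} → T v ≡ true → ¬ (U⁻ v ≡ true)
      T-not⁻ {v} h = not-elim (∧-elimʳ {(S ∖ ⟨ reserved ⟩ ∖ U⁺) v} h)

      t≤ : t ≤ gadget-size
      t≤ = let _ , _ , _ , _ , eq , le = path 0 z≤n in
        ≤-trans (≤-reflexive (trans (sym (+-identityʳ t)) (sym eq))) le

      overhead m : ℕ
      overhead = t + slack + 4
      m = ℓ ∸ overhead

      overhead≤ℓ : overhead ≤ ℓ
      overhead≤ℓ = ≤-trans (+-monoˡ-≤ 4 (+-monoˡ-≤ slack t≤)) ℓ-large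

      -- The cycle leaves the path at its last vertex, reaches `a` by the out-arm, crosses the
      -- gadget to `b` and returns by the in-arm to the first vertex. The pieces are disjoint
      -- because out-arms avoid the gadget, in-arms avoid both, and `T` avoids all three.
      close-up : LongPath {E = E} T m → Cycle E ℓ
      close-up P = subst (Cycle E) total (closed-walk⇒cycle
        ((out-edge ∷ Link.walk link⁺) +++ gadget-walk +++ (Link.walk link⁻ +++ (in-edge ∷ P.walk)))
        (unique-++ A₁-unique (unique-++ p-unique (unique-++ A₃-unique P.unique A₃∉A₄) p∉) A₁∉)
        (≤-trans (≤-trans (s≤s (s≤s z≤n)) (m≤n+m 4 (t + slack))) (≤-trans overhead≤ℓ (≤-reflexive (sym total)))))
        where
        module P = LongPath P
        last∈T : T P.last ≡ true
        last∈T = P.inside (end∈ P.walk)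
        first∈T : T P.first ≡ true
        first∈T = P.inside (here refl)
        arm⁺ = Arms.arm out (T⊆S _ last∈T) (T-not⁺ last∈T)
        arm⁻ = Arms.arm inn (T⊆S _ first∈T) (T-not⁻ first∈T)
        r r′ : Fin n
        r = proj₁ arm⁺
        r′ = proj₁ arm⁻
        out-edge : E P.last r ≡ true
        out-edge = proj₁ (proj₂ arm⁺)
        in-edge : E r′ P.first ≡ true
        in-edge = proj₁ (proj₂ arm⁻)
        r∉X : r ∉ X
        r∉X = proj₁ (proj₂ (proj₂ arm⁺))
        r′∉XW : r′ ∉ XW
        r′∉XW = proj₁ (proj₂ (proj₂ arm⁻))
        link⁺ : Link E S D (r ∷ X) r a
        link⁺ = proj₁ (proj₂ (proj₂ (proj₂ arm⁺)))
        link⁻ : Link E S D (r′ ∷ XW) b r′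
        link⁻ = proj₁ (proj₂ (proj₂ (proj₂ arm⁻)))
        c⁺ c⁻ : List (Fin n)
        c⁺ = Link.interior link⁺
        c⁻ = Link.interior link⁻
        ⊑W⁺ : r ∷ c⁺ ⊑ W⁺
        ⊑W⁺ = proj₂ (proj₂ (proj₂ (proj₂ arm⁺)))
        ⊑W⁻ : r′ ∷ c⁻ ⊑ W⁻
        ⊑W⁻ = proj₂ (proj₂ (proj₂ (proj₂ arm⁻)))
        i : ℕ
        -- The gadget makes up for the varying arms: the two interiors and `i` always add up to
        -- `slack`.
        i = slack ∸ (length c⁺ + length c⁻)
        segment = path i (m∸n≤m slack (length c⁺ + length c⁻))
        p A₁ A₃ A₄ : List (Fin n)
        p = proj₁ segment
        A₁ = r ∷ (c⁺ ∷ʳ a)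
        A₃ = c⁻ ∷ʳ r′
        A₄ = P.first ∷ P.rest
        gadget-walk : Walk E a p b
        gadget-walk = proj₁ (proj₂ segment)
        p-unique : Unique p
        p-unique = proj₁ (proj₂ (proj₂ segment))
        p⊑W : p ⊑ W
        p⊑W = proj₁ (proj₂ (proj₂ (proj₂ segment)))

        A₁-cases : ∀ {x} → x ∈ A₁ → (x ∈ W⁺ × x ∉ X) ⊎ x ≡ a
        A₁-cases (here refl) = inj₁ (⊑W⁺ (here refl) , r∉X)
        A₁-cases (there x∈) with ∈-∷ʳ⁻ c⁺ x∈
        ... | inj₁ x∈c = inj₁ (⊑W⁺ (there x∈c) , proj₂ (Link.free link⁺ x∈c) ∘ there)
        ... | inj₂ eq  = inj₂ eq
        A₁⊑XW : A₁ ⊑ XW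
        A₁⊑XW x∈ with A₁-cases x∈
        ... | inj₁ (x∈W , _) = ∈-++⁺ʳ X x∈W
        ... | inj₂ refl      = here refl
        A₃-cases : ∀ {x} → x ∈ A₃ → x ∈ W⁻ × x ∉ XW
        A₃-cases x∈ with ∈-∷ʳ⁻ c⁻ x∈
        ... | inj₁ x∈c = ⊑W⁻ (there x∈c) , proj₂ (Link.free link⁻ x∈c) ∘ there
        ... | inj₂ refl = ⊑W⁻ (here refl) , r′∉XW

        A₁-unique : Unique A₁
        A₁-unique = unique-∷
          (λ r∈′ → case ∈-∷ʳ⁻ c⁺ r∈′ of λ
            { (inj₁ r∈c) → proj₂ (Link.free link⁺ r∈c) (here refl)
            ; (inj₂ eq)  → r∉X (here eq) })
          (unique-∷ʳ (Link.unique link⁺) λ a∈ → proj₂ (Link.free link⁺ a∈) (there (here refl)))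
        A₃-unique : Unique A₃
        A₃-unique = unique-∷ʳ (Link.unique link⁻) λ r∈′ → proj₂ (Link.free link⁻ r∈′) (here refl)
        A₃∉A₄ : ∀ {x} → x ∈ A₃ → x ∉ A₄
        A₃∉A₄ x∈ x∈A₄ = T-free (P.inside x∈A₄) (∈-++⁺ʳ XW (proj₁ (A₃-cases x∈)))
        XW∉ : ∀ {x} → x ∈ XW → x ∉ A₃ ++ A₄
        XW∉ x∈ x∈′ with ∈-++⁻ A₃ x∈′
        ... | inj₁ x∈A₃ = proj₂ (A₃-cases x∈A₃) x∈
        ... | inj₂ x∈A₄ = T-free (P.inside x∈A₄) (∈-++⁺ˡ x∈)
        p∉ : ∀ {x} → x ∈ p → x ∉ A₃ ++ A₄
        p∉ x∈ = XW∉ (there (∈-++⁺ˡ (p⊑W x∈)))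
        A₁∉ : ∀ {x} → x ∈ A₁ → x ∉ p ++ A₃ ++ A₄
        A₁∉ x∈ x∈′ with ∈-++⁻ p x∈′
        ... | inj₂ x∈″ = XW∉ (A₁⊑XW x∈) x∈″
        ... | inj₁ x∈p with A₁-cases x∈
        ...   | inj₁ (_ , x∉X) = x∉X (there (p⊑W x∈p))
        ...   | inj₂ refl      = a∉W (p⊑W x∈p)

        total : length (A₁ ++ p ++ A₃ ++ A₄) ≡ ℓ
        total = trans (length-++ A₁) (trans (cong₂ _+_ (cong suc (length-∷ʳ c⁺ a))
          (trans (length-++ p) (cong₂ _+_ (proj₁ (proj₂ (proj₂ (proj₂ (proj₂ segment)))))
          (trans (length-++ A₃) (cong₂ _+_ (length-∷ʳ c⁻ r′) (cong suc P.size))))))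
          (trans (rearrange (length c⁺) t i (length c⁻) m)
          (trans (cong (λ s → t + s + 4 + m) (m+[n∸m]≡n (+-mono-≤ (Link.short link⁺) (Link.short link⁻))))
          (m+[n∸m]≡n overhead≤ℓ))))
          where
          rearrange : ∀ c t i c′ m → suc (suc c) + (t + i + (suc c′ + suc m)) ≡ t + (c + c′ + i) + 4 + m
          rearrange = solve-∀

      conclude : ¬ Cycle E ℓ → ⊥
      conclude no-cycle with long-path-or-cert noLoop m T
      ... | inj₁ P        = no-cycle (close-up P)
      ... | inj₂ (c , le) = no-cert-on T c {m} (≤-trans le (*-monoʳ-≤ m (card-mono {A = T} T⊆S))) few (m∸n≤m ℓ overhead)

  cycle : ¬ ¬ Cycle E ℓ
  cycle no-cycle = Abundance.flexible-gadget noLoop D κ B κ-budget connect fresh no-cert-off slack ≤-refl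
    λ g → let out = Outgoing.out-arms g in Assemble.conclude g out (Assemble.in-arms g out) no-cycle

-- The general case

module _ {n : ℕ} where

  -- Vectors are searched rather than functions: they split into head and tail without function
  -- extensionality.
  any-vec? : ∀ ℓ {P : Vec (Fin n) ℓ → Set} → (∀ v → Dec (P v)) → Dec (∃ P)
  any-vec? zero    P? = map′ ([] ,_) (λ { ([] , p) → p }) (P? [])
  any-vec? (suc ℓ) P? = map′ (λ (x , v , p) → x ∷ v , p) (λ { (x ∷ v , p) → x , v , p })
    (Fin.any? λ x → any-vec? ℓ λ v → P? (x ∷ v))

  IsCycle : Adj n → ∀ {ℓ} → (Fin ℓ → Fin n) → Set
  IsCycle E {ℓ} f =
    (∀ i j → f i ≡ f j → i ≡ j) ×
    (∀ i j → toℕ j ≡ suc (toℕ i) → E (f i) (f j) ≡ true) ×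
    (∀ i j → toℕ i ≡ ℓ ∸ 1 → toℕ j ≡ 0 → E (f i) (f j) ≡ true)

  isCycle? : ∀ E {ℓ} (f : Fin ℓ → Fin n) → Dec (IsCycle E f)
  isCycle? E {ℓ} f =
    (Fin.all? λ i → Fin.all? λ j → (f i Fin.≟ f j) →-dec (i Fin.≟ j)) ×-dec
    (Fin.all? λ i → Fin.all? λ j → (toℕ j ≟ suc (toℕ i)) →-dec (E (f i) (f j) ≟ᵇ true)) ×-dec
    (Fin.all? λ i → Fin.all? λ j → (toℕ i ≟ ℓ ∸ 1) →-dec ((toℕ j ≟ 0) →-dec (E (f i) (f j) ≟ᵇ true)))

  -- A cycle is only shown not to be impossible; the finite search turns this into a cycle.
  cycle? : ∀ E ℓ → Dec (Cycle {n} E ℓ)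
  cycle? E ℓ = map′
    (λ (2≤ , v , inj , next , close) → record
      { len≥2 = 2≤ ; vert = Vec.lookup v ; inS = λ _ → refl ; inj = inj ; step = next ; close = close })
    (λ c → let open CycleIn c
               at = lookup∘tabulate vert
               edge = λ i j → subst₂ (λ x y → E x y ≡ true) (sym (at i)) (sym (at j))
           in len≥2 , Vec.tabulate vert ,
              (λ i j eq → inj i j (trans (sym (at i)) (trans eq (at j)))) ,
              (λ i j eq → edge i j (CycleIn.step c i j eq)) ,
              (λ i j e₁ e₂ → edge i j (close i j e₁ e₂)))
    ((2 ≤? ℓ) ×-dec any-vec? ℓ (isCycle? E ∘ Vec.lookup))

module _ {n} {E : Adj n} (noLoop : ∀ v → E v v ≡ false) {K q ℓ : ℕ} (0<K : 0 < K)
  (q-large : Constants.threshold K ≤ q) (n≤Kq : n ≤ K * q) (ℓ-large : Constants.least-length K ≤ ℓ) where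

  -- Induction on |S|. A small `S` may lose all its edges, and a sparse cut combines the
  -- certificates of its two parts; otherwise `S` expands, and without a certificate it would
  -- contain the cycle. The square pays for the cuts: (x + y)² exceeds x² + y² by 2xy, and a sparse
  -- cut between parts of sizes x and y loses at most xy/K edges.
  cheap-cert : ¬ Cycle E ℓ → ∀ s (S : VSet n) → card S ≤ s →
               ¬ ¬ ∃ λ c → 2 * K * bad c E S ≤ 2 * K * (ℓ + q) * card S + card S * card S
  cheap-cert no-cycle s S S≤s k with card S ≤? ℓ + q
  ... | yes S≤β = k (trivial-cert , ≤-trans (*-monoʳ-≤ (2 * K) (≤-trans (bad≤card² trivial-cert E S) (*-monoˡ-≤ (card S) S≤β)))
    (≤-trans (≤-reflexive (sym (*-assoc (2 * K) (ℓ + q) (card S)))) (m≤m+n _ _)))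
  cheap-cert no-cycle zero    S S≤s k | no S≰β = S≰β (≤-trans S≤s z≤n)
  cheap-cert no-cycle (suc s) S S≤s k | no S≰β =
    Core.cycle noLoop {K} {q} {ℓ} {S} 0<K q-large (≤-trans (m≤n+m q ℓ) (<⇒≤ (≰⇒> S≰β))) (≤-trans (card≤n S) n≤Kq)
      ℓ-large expanding no-cert no-cycle
    where
    no-cert : ∀ c → ¬ (bad c E S ≤ (ℓ + q) * card S)
    no-cert c le = k (c , ≤-trans (*-monoʳ-≤ (2 * K) le)
      (≤-trans (≤-reflexive (sym (*-assoc (2 * K) (ℓ + q) (card S)))) (m≤m+n _ _)))
    expanding : Expanding E K S
    expanding A 0<∩ 0<∖ with card (S ∩ A) * card (S ∖ A) <? K * edges E (S ∩ A) (S ∖ A)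
    ... | yes lt = lt
    ... | no ≮ = ⊥-elim (
      cheap-cert no-cycle s (S ∩ A) (smaller 0<∖ (≤-trans (card-∩∖ S A) S≤s)) λ (c , hc) →
      cheap-cert no-cycle s (S ∖ A) (smaller 0<∩ (≤-trans (≤-reflexive (+-comm (card (S ∖ A)) _)) (≤-trans (card-∩∖ S A) S≤s))) λ (d , hd) →
      k (combine A c d , bound {ℓ + q} {y = bad c E (S ∩ A)} {bad d E (S ∖ A)} {edges E (S ∩ A) (S ∖ A)} (bad-combine E S A c d) hc hd (≮⇒≥ ≮) (card-∩∖ S A)))
      where
      smaller : ∀ {x y} → 0 < y → x + y ≤ suc s → x ≤ s
      smaller {x} {y} 0<y le = ≤-pred (≤-trans (≤-reflexive (+-comm 1 x)) (≤-trans (+-monoʳ-≤ x 0<y) le))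
      bound : ∀ {β x y z e a b t} → x ≤ y + z + e → 2 * K * y ≤ 2 * K * β * a + a * a →
              2 * K * z ≤ 2 * K * β * b + b * b → K * e ≤ a * b → a + b ≤ t → 2 * K * x ≤ 2 * K * β * t + t * t
      bound {β} {x} {y} {z} {e} {a} {b} {t} x≤ y≤ z≤ e≤ ab≤ = begin
        2 * K * x                                                       ≤⟨ *-monoʳ-≤ (2 * K) x≤ ⟩
        2 * K * (y + z + e)                                             ≡⟨ expand K y z e ⟩
        2 * K * y + 2 * K * z + 2 * (K * e)                             ≤⟨ +-mono-≤ (+-mono-≤ y≤ z≤) (*-monoʳ-≤ 2 e≤) ⟩
        2 * K * β * a + a * a + (2 * K * β * b + b * b) + 2 * (a * b)   ≡⟨ collect (2 * K * β) a b ⟩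
        2 * K * β * (a + b) + (a + b) * (a + b)                         ≤⟨ +-mono-≤ (*-monoʳ-≤ (2 * K * β) ab≤) (*-mono-≤ ab≤ ab≤) ⟩
        2 * K * β * t + t * t                                           ∎
        where
        open ≤-Reasoning
        expand : ∀ k y z e → 2 * k * (y + z + e) ≡ 2 * k * y + 2 * k * z + 2 * (k * e)
        expand = solve-∀
        collect : ∀ m a b → m * a + a * a + (m * b + b * b) + 2 * (a * b) ≡ m * (a + b) + (a + b) * (a + b)
        collect = solve-∀

-- Clearing denominators and the final count

open import Data.Integer using (+_; -[1+_])

toℚ-ᵘ : ∀ m → ℚ.toℚᵘ (toℚ m) ≃ᵘ mkℚᵘ (+ m) 0
toℚ-ᵘ m = ℚ.toℚᵘ-fromℚᵘ (mkℚᵘ (+ m) 0)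

*toℚ-ᵘ : ∀ p N → ℚ.toℚᵘ (p *ℚ toℚ N) ≃ᵘ ℚ.toℚᵘ p *ᵘ mkℚᵘ (+ N) 0
*toℚ-ᵘ p N = ℚᵘ.≃-trans (ℚ.toℚᵘ-homo-* p (toℚ N)) (ℚᵘ.*-congˡ {ℚ.toℚᵘ p} (toℚ-ᵘ N))

-- Unnormalised products keep their denominators, so the inequality becomes integral by
-- cross-multiplication.
scaled≤⇒ : ∀ p N m → p *ℚ toℚ N ≤ℚ toℚ m → ↥ p ℤ.* + N ℤ.≤ + m ℤ.* ↧ p
scaled≤⇒ p@(mkℚ a b _) N m h = subst₂ ℤ._≤_ (ℤ.*-identityʳ _) (cong (λ d → + m ℤ.* + d) (*-identityʳ (suc b)))
  (ℚᵘ.drop-*≤* (ℚᵘ.≤-respʳ-≃ (toℚ-ᵘ m) (ℚᵘ.≤-respˡ-≃ (*toℚ-ᵘ p N) (ℚ.toℚᵘ-mono-≤ h))))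

≤scaled⇒ : ∀ p r N m → toℚ m ≤ℚ r *ℚ p *ℚ toℚ N → + m ℤ.* (↧ r ℤ.* ↧ p) ℤ.≤ ↥ r ℤ.* ↥ p ℤ.* + N
≤scaled⇒ p@(mkℚ a b _) r@(mkℚ c d _) N m h =
  subst₂ ℤ._≤_ (cong (λ e → + m ℤ.* + e) (*-identityʳ (suc d * suc b))) (ℤ.*-identityʳ _)
  (ℚᵘ.drop-*≤* (ℚᵘ.≤-respʳ-≃ (ℚᵘ.≃-trans (*toℚ-ᵘ (r *ℚ p) N) (ℚᵘ.*-congʳ (ℚ.toℚᵘ-homo-* r p)))
    (ℚᵘ.≤-respˡ-≃ (toℚ-ᵘ m) (ℚ.toℚᵘ-mono-≤ h))))

-- With θ = (a+1)/(b+1) and r/(r+1) an upper bound for 1 - δ, multiplication by 2K = 6(b+1)(r+1)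
-- compares 6(r+1)(a+1)n² with 6r(a+1)n² + 5n², where 4n² comes from `q` and n² from the cuts. The
-- former is larger by (6a+1)n².
no-small-cert : ∀ a b r ℓ m n → 0 < n → ∀ q → (let K = 3 * (suc b * suc r)) →
  suc a * (n * n) ≤ m * suc b → ℓ * (suc r * suc b) ≤ r * suc a * n → K * q ≤ 2 * n →
  ¬ (2 * K * m ≤ 2 * K * (ℓ + q) * n + n * n)
no-small-cert a b r ℓ m n 0<n q λ≥ ℓ≤ q≤ m≤ =
  <⇒≱ (m<m+n (6 * (r * suc a) * (n * n) + 5 * (n * n)) {(6 * a + 1) * (n * n)}
        (*-mono-≤ {1} {6 * a + 1} (m≤n+m 1 (6 * a)) (*-mono-≤ 0<n 0<n))) (begin
    6 * (r * suc a) * (n * n) + 5 * (n * n) + (6 * a + 1) * (n * n)        ≡⟨ lhs r a (n * n) ⟩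
    6 * suc r * (suc a * (n * n))                                          ≤⟨ *-monoʳ-≤ (6 * suc r) λ≥ ⟩
    6 * suc r * (m * suc b)                                                ≡⟨ middle r m b ⟩
    2 * (3 * (suc b * suc r)) * m                                          ≤⟨ m≤ ⟩
    2 * (3 * (suc b * suc r)) * (ℓ + q) * n + n * n                        ≡⟨ split (suc b) (suc r) ℓ q n ⟩
    6 * (ℓ * (suc r * suc b)) * n + 2 * (3 * (suc b * suc r) * q) * n + n * n
      ≤⟨ +-monoˡ-≤ (n * n) (+-mono-≤ (*-monoˡ-≤ n (*-monoʳ-≤ 6 ℓ≤)) (*-monoˡ-≤ n (*-monoʳ-≤ 2 q≤))) ⟩
    6 * (r * suc a * n) * n + 2 * (2 * n) * n + n * n                      ≡⟨ rhs (r * suc a) n ⟩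
    6 * (r * suc a) * (n * n) + 5 * (n * n)                                ∎)
  where
  open ≤-Reasoning
  lhs : ∀ r a N → 6 * (r * suc a) * N + 5 * N + (6 * a + 1) * N ≡ 6 * suc r * (suc a * N)
  lhs = solve-∀
  middle : ∀ r m b → 6 * suc r * (m * suc b) ≡ 2 * (3 * (suc b * suc r)) * m
  middle = solve-∀
  split : ∀ b r ℓ q n → 2 * (3 * (b * r)) * (ℓ + q) * n + n * n ≡ 6 * (ℓ * (r * b)) * n + 2 * (3 * (b * r) * q) * n + n * n
  split = solve-∀
  rhs : ∀ x n → 6 * (x * n) * n + 2 * (2 * n) * n + n * n ≡ 6 * x * (n * n) + 5 * (n * n)
  rhs = solve-∀

numerator-pos : ∀ p → 0ℚ <ℚ p → ∃ λ a → ↥ p ≡ + suc a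
numerator-pos (mkℚ (+ suc a) _ _)  _ = a , refl
numerator-pos (mkℚ (+ zero) _ _)   (ℚ.*<* (ℤ.+<+ ()))
numerator-pos (mkℚ -[1+ _ ] _ _)   (ℚ.*<* ())

1-δ<1 : ∀ {δ} → 0ℚ <ℚ δ → 1ℚ - δ <ℚ 1ℚ
1-δ<1 {δ} 0<δ = subst (1ℚ - δ <ℚ_) (ℚ.+-identityʳ 1ℚ) (ℚ.+-monoʳ-< 1ℚ (ℚ.neg-antimono-< 0<δ))

-- By integrality a rational below 1 with denominator d + 1 is at most d/(d+1), which bounds the gap
-- below 1 by the denominator alone.
numerator<1 : ∀ r → r <ℚ 1ℚ → ↥ r ℤ.≤ + (ℚ.denominator-1 r)
numerator<1 r@(mkℚ c d _) h = ℤ.i<j⇒i≤pred[j] (subst₂ ℤ._<_ (ℤ.*-identityʳ c) (ℤ.*-identityˡ (+ suc d)) (ℚ.drop-*<* h))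

theorem1p5 : (δ θ : ℚ) → 0ℚ <ℚ δ → δ <ℚ 1ℚ → 0ℚ <ℚ θ → θ <ℚ 1ℚ →
    Σ ℕ λ C → Σ ℕ λ n₀ → ∀ (n : ℕ) → n₀ ≤ n → (G : Digraph n) →
    λ≥ℚ G (θ *ℚ toℚ (n * n)) →
    ∀ (ℓ : ℕ) → C ≤ ℓ → toℚ ℓ ≤ℚ (1ℚ - δ) *ℚ θ *ℚ toℚ n → Cycle (E G) ℓ
-- The summand `threshold * K` gives `q = suc (n / K)` its required size; the summand `K` gives
-- `K ≤ n`, hence `K * q ≤ 2 * n`.
theorem1p5 δ θ 0<δ _ 0<θ _ = Constants.least-length K , Constants.threshold K * K + K , λ n n₀≤n G λ≥ ℓ C≤ℓ ℓ≤ →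
  decidable-stable (cycle? (E G) ℓ) λ no-cycle →
  cheap-cert (noLoop G) {K} {suc (n / K)} {ℓ} 0<K
    (m≤n⇒m≤1+n (subst (_≤ n / K) (m*n/n≡m (Constants.threshold K) K) (/-monoˡ-≤ K (≤-trans (m≤m+n _ K) n₀≤n))))
    (n≤Kq n) C≤ℓ no-cycle n all₁ (≤-reflexive (card-all n)) λ (c , cheap) →
  no-small-cert a b (ℚ.denominator-1 r) ℓ (bad c (E G) all₁) n (≤-trans 0<K (≤-trans (m≤n+m K _) n₀≤n)) (suc (n / K))
    (deletions n G λ≥ c) (length-bound n ℓ ℓ≤) (Kq≤2n n (≤-trans (m≤n+m K _) n₀≤n))
    (subst (λ s → 2 * K * bad c (E G) all₁ ≤ 2 * K * (ℓ + suc (n / K)) * s + s * s) (card-all n) cheap)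
  where
  r : ℚ
  r = 1ℚ - δ
  a b K : ℕ
  a = proj₁ (numerator-pos θ 0<θ)
  b = ℚ.denominator-1 θ
  -- Makes the total error 5n²/(2K) of the sparse cuts and of q = 1 + n/K less than δθn².
  K = 3 * (suc b * suc (ℚ.denominator-1 r))
  num : ↥ θ ≡ + suc a
  num = proj₂ (numerator-pos θ 0<θ)
  0<K : 0 < K
  0<K = s≤s z≤n
  n≤Kq : ∀ n → n ≤ K * suc (n / K)
  n≤Kq n = ≤-trans (≤-reflexive (m≡m%n+[m/n]*n n K)) (≤-trans (+-mono-≤ (<⇒≤ (m%n<n n K)) (≤-reflexive (*-comm (n / K) K)))
    (≤-reflexive (sym (*-suc K (n / K)))))
  Kq≤2n : ∀ n → K ≤ n → K * suc (n / K) ≤ 2 * n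
  Kq≤2n n K≤n = ≤-trans (≤-reflexive (*-suc K (n / K)))
    (+-mono-≤ K≤n (≤-trans (≤-reflexive (*-comm K (n / K))) (≤-trans (m/n*n≤m n K) (≤-reflexive (sym (+-identityʳ n))))))
  deletions : ∀ n (G : Digraph n) → λ≥ℚ G (θ *ℚ toℚ (n * n)) → ∀ c → suc a * (n * n) ≤ bad c (E G) all₁ * suc b
  deletions n G λ≥ c = ≤-trans (ℤ.drop‿+≤+ (subst₂ ℤ._≤_
      (trans (cong (ℤ._* + (n * n)) num) (sym (ℤ.pos-* (suc a) (n * n))))
      (sym (ℤ.pos-* (deleted (E G) (kept c (E G))) (suc b)))
      (scaled≤⇒ θ (n * n) (deleted (E G) (kept c (E G))) (λ≥ (kept c (E G)) (λ _ _ → ∧-elimˡ) (kept-pseudoperiodic c)))))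
    (*-monoˡ-≤ (suc b) (deleted≤bad c (E G)))
  length-bound : ∀ n ℓ → toℚ ℓ ≤ℚ r *ℚ θ *ℚ toℚ n → ℓ * (suc (ℚ.denominator-1 r) * suc b) ≤ ℚ.denominator-1 r * suc a * n
  length-bound n ℓ ℓ≤ = ℤ.drop‿+≤+ (subst₂ ℤ._≤_
    (trans (cong (+ ℓ ℤ.*_) (sym (ℤ.pos-* (suc (ℚ.denominator-1 r)) (suc b)))) (sym (ℤ.pos-* ℓ _)))
    (trans (cong (ℤ._* + n) (sym (ℤ.pos-* (ℚ.denominator-1 r) (suc a)))) (sym (ℤ.pos-* (ℚ.denominator-1 r * suc a) n)))
    (ℤ.≤-trans (≤scaled⇒ θ r n ℓ ℓ≤) (ℤ.*-monoʳ-≤-nonNeg (+ n)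
      (subst (λ t → ↥ r ℤ.* t ℤ.≤ + ℚ.denominator-1 r ℤ.* + suc a) (sym num)
        (ℤ.*-monoʳ-≤-nonNeg (+ suc a) (numerator<1 r (1-δ<1 0<δ)))))))
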